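{- Let $t > 2$ and $1 \leq k_1 \leq \cdots \leq k_t$ be integers with $n = k_1 + \cdots + k_t \geq 4$, let $K_{k_1,\ldots,k_t}$ have vertex set $[n]$, and let $X$ be a tree on $n$ vertices. If $X$ does not contain an $(n-k_t)$-bridge, then for any $i, j \in [n]$ and any bijection $\sigma: V(X) \to [n]$ with $\{\sigma^{ -1}(i), \sigma^{ -1}(j)\} \in E(X)$, the vertices $i$ and $j$ are $(X, K_{k_1,\ldots,k_t})$-exchangeable from $\sigma$.
   Context: All graphs are simple. For graphs $X, Y$ on $n$ vertices, the friends-and-strangers graph $\mathsf{FS}(X,Y)$ has as vertices all bijections $\sigma: V(X) \to V(Y)$; two bijections $\sigma, \sigma'$ are adjacent iff there is an edge $\{a,b\} \in E(X)$ with $\{\sigma(a),\sigma(b)\} \in E(Y)$, $\sigma'(a) = \sigma(b)$, $\sigma'(b) = \sigma(a)$, and $\sigma'(c) = \sigma(c)$ for all other $c$ (an $(X,Y)$-friendly swap). For a bijection $\sigma$ and $u, v \in V(Y)$, $u$ and $v$ are $(X,Y)$-exchangeable from $\sigma$ if some sequence of $(X,Y)$-friendly swaps takes $\sigma$ to $(u\; v)\circ\sigma$. $K_{k_1,\ldots,k_t}$ is the complete $t$-partite graph with classes of sizes $k_1,\ldots,k_t$. A path $v_1, \ldots, v_k$ in a graph is a $k$-bridge if each edge of the path is a cut-edge, $v_2,\ldots,v_{k-1}$ have degree $2$, and $v_1, v_k$ do not have degree $1$; a single cut-vertex is a $1$-bridge. -}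

module Defs where

open import Data.Bool using (Bool; true; false; T; not; if_then_else_; _∧_)
open import Data.Nat using (ℕ; zero; suc; _+_; _∸_; _<ᵇ_; _≡ᵇ_)
open import Data.Fin using (Fin; zero; suc; toℕ; inject₁; fromℕ)
open import Data.Fin.Permutation.Components using (transpose)
open import Data.List using (List; []; _∷_; map; allFin)
open import Data.Nat.ListAction using (sum)
open import Data.Product using (Σ; ∃; ∃-syntax; _×_; _,_)
open import Data.Sum using (_⊎_)
open import Relation.Nullary using (¬_)
open import Relation.Binary.PropositionalEquality using (_≡_; _≢_; refl; cong)
open import Relation.Binary.Construct.Closure.ReflexiveTransitive using (Star)
open import Function.Definitions using (Injective)

record Graph (n : ℕ) : Set where
  field
    Adj    : Fin n → Fin n → Bool
    sym    : ∀ u v → Adj u v ≡ Adj v u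
    irrefl : ∀ v → Adj v v ≡ false
open Graph public

module _ {n : ℕ} (G : Graph n) where

  Edge : Fin n → Fin n → Set
  Edge u v = T (Adj G u v)

  Connected : Fin n → Fin n → Set
  Connected = Star Edge

  EdgeMinus : Fin n → Fin n → Fin n → Fin n → Set
  EdgeMinus a b u v = Edge u v × ¬ ((u ≡ a × v ≡ b) ⊎ (u ≡ b × v ≡ a))

  EdgeAvoid : Fin n → Fin n → Fin n → Set
  EdgeAvoid w u v = Edge u v × u ≢ w × v ≢ w

  -- {a,b} is a cut-edge: an edge whose deletion disconnects its endpoints
  -- (equivalently, increases the number of components)
  CutEdge : Fin n → Fin n → Set
  CutEdge a b = Edge a b × ¬ Star (EdgeMinus a b) a b

  CutVertex : Fin n → Set
  CutVertex w = ∃[ x ] ∃[ y ] (x ≢ w × y ≢ w × Connected x y × ¬ Star (EdgeAvoid w) x y)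

  degree : Fin n → ℕ
  degree v = sum (map (λ u → if Adj G v u then 1 else 0) (allFin n))

  HasCycle : Set
  HasCycle = ∃[ l ] Σ (Fin (suc (suc (suc l))) → Fin n) λ c →
    Injective _≡_ _≡_ c
    × (∀ (i : Fin (suc (suc l))) → Edge (c (inject₁ i)) (c (suc i)))
    × Edge (c (fromℕ (suc (suc l)))) (c zero)

  IsTree : Set
  IsTree = (∀ u v → Connected u v) × ¬ HasCycle

  IsPath : (l : ℕ) → (Fin (suc l) → Fin n) → Set
  IsPath l p = Injective _≡_ _≡_ p × (∀ (i : Fin l) → Edge (p (inject₁ i)) (p (suc i)))

  -- the path p_0, ..., p_l is an (l+1)-bridge
  IsBridge : (l : ℕ) → (Fin (suc l) → Fin n) → Set
  IsBridge zero    p = CutVertex (p zero)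
  IsBridge (suc l) p =
    (∀ (i : Fin (suc l)) → CutEdge (p (inject₁ i)) (p (suc i)))
    × (∀ (j : Fin (suc (suc l))) → j ≢ zero → j ≢ fromℕ (suc l) → degree (p j) ≡ 2)
    × degree (p zero) ≢ 1
    × degree (p (fromℕ (suc l))) ≢ 1

  HasBridge : ℕ → Set
  HasBridge k = ∃[ l ] (suc l ≡ k × Σ (Fin (suc l) → Fin n) λ p → IsPath l p × IsBridge l p)

-- Complete multipartite graph on [n] with classes of sizes ks, the classes being
-- consecutive blocks of [n] = {0,...,n-1} in order.
partOf : ℕ → List ℕ → ℕ
partOf v []       = 0
partOf v (k ∷ ks) = if v <ᵇ k then 0 else suc (partOf (v ∸ k) ks)

multipartiteAdj : (n : ℕ) → List ℕ → Fin n → Fin n → Bool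
multipartiteAdj n ks u v = not (partOf (toℕ u) ks ≡ᵇ partOf (toℕ v) ks)

private
  ≡ᵇ-sym : ∀ a b → (a ≡ᵇ b) ≡ (b ≡ᵇ a)
  ≡ᵇ-sym zero    zero    = refl
  ≡ᵇ-sym zero    (suc b) = refl
  ≡ᵇ-sym (suc a) zero    = refl
  ≡ᵇ-sym (suc a) (suc b) = ≡ᵇ-sym a b

  ≡ᵇ-refl : ∀ a → (a ≡ᵇ a) ≡ true
  ≡ᵇ-refl zero    = refl
  ≡ᵇ-refl (suc a) = ≡ᵇ-refl a

CompleteMultipartite : (n : ℕ) → List ℕ → Graph n
CompleteMultipartite n ks = record
  { Adj    = multipartiteAdj n ks
  ; sym    = λ u v → cong not (≡ᵇ-sym (partOf (toℕ u) ks) (partOf (toℕ v) ks))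
  ; irrefl = λ v → cong not (≡ᵇ-refl (partOf (toℕ v) ks))
  }

-- Friends-and-strangers: σ, σ' : V(X) → V(Y) (bijections), σ' is obtained from σ
-- by an (X,Y)-friendly swap across the edge {a,b} of X.
module _ {n : ℕ} (X Y : Graph n) where

  FriendlySwap : (Fin n → Fin n) → (Fin n → Fin n) → Set
  FriendlySwap σ σ' = ∃[ a ] ∃[ b ]
    ( Edge X a b × Edge Y (σ a) (σ b)
    × σ' a ≡ σ b × σ' b ≡ σ a
    × (∀ c → c ≢ a → c ≢ b → σ' c ≡ σ c))

  Exchangeable : (Fin n → Fin n) → Fin n → Fin n → Set
  Exchangeable σ u v = ∃[ τ ] (Star FriendlySwap σ τ × (∀ c → τ c ≡ transpose u v (σ c)))

{-# OPTIONS --safe #-}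
module Submission where

-- Colour every person by their class.  On a connected vertex set every rearrangement
-- of colours is attainable, since a swap of two equal colours can be skipped.  Fix
-- the class c of i and j, and call its members pebbles.  Exchangeability of two
-- pebbles is unaffected by moving to another configuration (undo the move with
-- the two pebbles interchanged) and is transitive.
--
-- By induction on a vertex set S inducing a subtree that carries all non-pebbles
-- and has no m-bridge, m being the number of people outside the largest class,
-- any two pebbles in S are exchangeable.  If S carries a third pebble, take a longest
-- path in S.  Each of its ends l, l' is a leaf whose neighbour has at most one
-- non-leaf neighbour, so deleting it creates no new bridge.  Place pebbles on l
-- and l': the pebbles off l are exchangeable in S - l, those off l' in S - l', and
-- a third pebble links the two on l and l'.  If S carries just two pebbles, it has
-- at least m + 2 vertices, hence a vertex of degree 3: otherwise a longest path
-- covers S and contains an m-bridge.  Place the two pebbles on that vertex and on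
-- one of its neighbours, place two different other colours on two further
-- neighbours, and exchange the pebbles there directly.

open import Defs hiding (sym)
open import Data.Bool using (true; false; T; if_then_else_)
open import Data.Bool.Properties using (T?)
open import Data.Empty using (⊥)
open import Data.Fin using (Fin; zero; suc; inject₁; fromℕ; toℕ; fromℕ<)
open import Data.Fin.Permutation using (Permutation′; _⟨$⟩ʳ_; _⟨$⟩ˡ_; inverseʳ; inverseˡ)
open import Data.Fin.Permutation.Components using (transpose)
open import Data.Fin.Properties using (_≟_; any?; toℕ<n; toℕ-injective; toℕ-fromℕ<; toℕ-fromℕ)
open import Data.Fin.Subset using (Subset; _∈_; _∉_; _-_; inside; outside; ∣_∣; ⊤)
open import Data.Fin.Subset.Properties using (_∈?_; p─q⊆p; x∈p∧x≢y⇒x∈p-y; x∈p⇒∣p-x∣<∣p∣; ∈⊤; ∣p∣≤n)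
open import Data.List using (List; []; _∷_; map; [_]; _++_; length; lookup; reverse; reverseAcc; allFin; filter; tabulate; upTo)
open import Data.List.Membership.DecPropositional using () renaming (_∈?_ to ∈ˡ-dec)
open import Data.List.Membership.Propositional using () renaming (_∈_ to _∈ˡ_; _∉_ to _∉ˡ_)
open import Data.List.Membership.Propositional.Properties using (∈-map⁻; ∈-∃++; ∈-allFin; ∈-lookup; ∈-++⁻; ∈-++⁺ˡ; ∈-++⁺ʳ; ∈-map⁺; ∈-length; ∈-filter⁺; ∈-filter⁻; ∈-upTo⁺)
open import Data.List.Properties using (length-++; length-tabulate; length-reverse; ++-assoc; reverse-++; unfold-reverse; ∷-injectiveˡ; length-map; length-upTo)
open import Data.List.Relation.Binary.Permutation.Propositional using (↭⇒↭ₛ; ↭-sym)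
open import Data.List.Relation.Binary.Permutation.Propositional.Properties using (↭-reverse)
open import Data.List.Relation.Binary.Pointwise using (Pointwise; []; _∷_)
open import Data.List.Relation.Unary.All using (All; []; _∷_)
open import Data.List.Relation.Unary.AllPairs using ([]; _∷_)
open import Data.List.Relation.Unary.Any using (here; there)
open import Data.List.Relation.Unary.Linked using (Linked; []; [-]; _∷_; linked?)
open import Data.List.Relation.Unary.Unique.Propositional using (Unique)
open import Data.Nat using (ℕ; suc; _≤_; _<_; _∸_; zero; _+_; z≤n; s≤s; _<ᵇ_; _≡ᵇ_)
open import Data.Nat.ListAction using (sum)
open import Data.Product using (∃; ∃-syntax; _×_; _,_; proj₁; proj₂)
open import Data.Sum using (_⊎_; inj₁; inj₂)
open import Data.Unit using (tt)
open import Function using (_∘_; id)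
open import Function.Definitions using (Injective)
open import Relation.Binary.Construct.Closure.ReflexiveTransitive using (Star; ε; _◅_; _◅◅_)
open import Relation.Binary.PropositionalEquality using (_≡_; _≢_; refl; sym; trans; cong; subst; subst₂; setoid)
open import Relation.Nullary using (¬_; yes; no; contradiction; Dec)
open import Relation.Nullary.Decidable using (dec-true; dec-false; _×-dec_; map′; ¬?)
open import Relation.Unary using (Decidable)
import Data.Fin as F
import Data.List.Relation.Binary.Permutation.Setoid.Properties as Permₛ
import Data.List.Relation.Unary.All as All
import Data.List.Relation.Unary.All.Properties as Allₚ
import Data.List.Relation.Unary.Any.Properties as Anyₚ
import Data.List.Relation.Unary.Linked as Linked
import Data.List.Relation.Unary.Unique.DecPropositional as UniqueDec
import Data.List.Relation.Unary.Unique.Propositional.Properties as Uniqueₚ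
import Data.Nat as ℕ
import Data.Nat.Properties as ℕₚ
import Data.Vec as Vec
import Relation.Binary.Construct.Closure.ReflexiveTransitive as Star

-- Transpositions of a finite set.

module _ {n : ℕ} where

  transpose-left : ∀ (i j : Fin n) → transpose i j i ≡ j
  transpose-left i j rewrite dec-true (i ≟ i) refl = refl

  transpose-right : ∀ (i j : Fin n) → transpose i j j ≡ i
  transpose-right i j with j ≟ i
  ... | yes j≡i = j≡i
  ... | no  _ rewrite dec-true (j ≟ j) refl = refl

  transpose-other : ∀ {i j k : Fin n} → k ≢ i → k ≢ j → transpose i j k ≡ k
  transpose-other {i} {j} {k} k≢i k≢j
    rewrite dec-false (k ≟ i) k≢i | dec-false (k ≟ j) k≢j = refl

  data TransposeView (i j : Fin n) : Fin n → Set where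
    left  : TransposeView i j i
    right : TransposeView i j j
    other : ∀ {k} → k ≢ i → k ≢ j → TransposeView i j k

  transposeView : ∀ i j k → TransposeView i j k
  transposeView i j k with k ≟ i | k ≟ j
  ... | yes refl | _        = left
  ... | no  _    | yes refl = right
  ... | no  k≢i  | no k≢j   = other k≢i k≢j

  transpose-comm : ∀ (i j k : Fin n) → transpose i j k ≡ transpose j i k
  transpose-comm i j k with transposeView i j k
  ... | left  = trans (transpose-left i j) (sym (transpose-right j i))
  ... | right = trans (transpose-right i j) (sym (transpose-left j i))
  ... | other p q = trans (transpose-other p q) (sym (transpose-other q p))

  transpose-involutive : ∀ (i j k : Fin n) → transpose i j (transpose i j k) ≡ k
  transpose-involutive i j k with transposeView i j k
  ... | left  = trans (cong (transpose i j) (transpose-left i j)) (transpose-right i j)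
  ... | right = trans (cong (transpose i j) (transpose-right i j)) (transpose-left i j)
  ... | other p q = trans (cong (transpose i j) (transpose-other p q)) (transpose-other p q)

  transpose-injective : ∀ (i j : Fin n) → Injective _≡_ _≡_ (transpose i j)
  transpose-injective i j {x} {y} eq = trans (sym (transpose-involutive i j x))
    (trans (cong (transpose i j) eq) (transpose-involutive i j y))

  -- Builds the transposition of two far-apart points out of nearer ones: along a walk in
  -- `recolour`, and along a chain of people in `Exchangeable-trans`.
  transpose-conjugate : ∀ {i j k : Fin n} → i ≢ j → k ≢ i → k ≢ j → ∀ c →
    transpose i j (transpose j k (transpose i j c)) ≡ transpose i k c
  transpose-conjugate {i} {j} {k} i≢j k≢i k≢j c with transposeView i j c
  ... | left  rewrite transpose-left i j | transpose-left j k
                    | transpose-other {i} {j} k≢i k≢j | transpose-left i k = refl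
  ... | right rewrite transpose-right i j | transpose-other {j} {k} i≢j (k≢i ∘ sym)
                    | transpose-left i j | transpose-other {i} {k} {j} (i≢j ∘ sym) (k≢j ∘ sym) = refl
  ... | other p q rewrite transpose-other p q with transposeView j k c
  ...   | left = contradiction refl q
  ...   | right rewrite transpose-right j k | transpose-right i j | transpose-right i k = refl
  ...   | other _ r rewrite transpose-other q r | transpose-other p q | transpose-other p r = refl

-- Induced subgraphs.

EdgeIn : ∀ {n} → Graph n → Subset n → Fin n → Fin n → Set
EdgeIn X S u v = u ∈ S × v ∈ S × Edge X u v

ConnectedIn : ∀ {n} → Graph n → Subset n → Set
ConnectedIn X S = ∀ {u v} → u ∈ S → v ∈ S → Star (EdgeIn X S) u v

Edge-sym : ∀ {n} (X : Graph n) {u v} → Edge X u v → Edge X v u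
Edge-sym X {u} {v} e rewrite Graph.sym X u v = e

Edge-irrefl : ∀ {n} (X : Graph n) {u v} → Edge X u v → u ≢ v
Edge-irrefl X {u} e refl rewrite Graph.irrefl X u = e

InImage : ∀ {n} → Subset n → (Fin n → Fin n) → Fin n → Set
InImage S σ l = ∃[ a ] (a ∈ S × σ a ≡ l)

-- Degree at least three in the subgraph induced on `S`, given by witnesses because the exchange
-- moves people along three named arms.
record Junction {n} (X : Graph n) (S : Subset n) : Set where
  field
    {w x y z}   : Fin n
    w∈ : w ∈ S
    x∈ : x ∈ S
    y∈ : y ∈ S
    z∈ : z ∈ S
    wx : Edge X w x
    wy : Edge X w y
    wz : Edge X w z
    x≢y : x ≢ y
    x≢z : x ≢ z
    y≢z : y ≢ z

-- Swaps confined to a vertex set, and rearrangements of colours.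

module Swapping {n : ℕ} (X Y : Graph n) (colour : Fin n → ℕ)
  (colour⇒Edge : ∀ {u v} → colour u ≢ colour v → Edge Y u v)
  (Edge⇒colour : ∀ {u v} → Edge Y u v → colour u ≢ colour v)
  where

  -- Adjacency in `Y` appears as difference of colours. Both places lie in `S`, so the set of people
  -- standing in `S` is invariant.
  record SwapIn (S : Subset n) (σ σ' : Fin n → Fin n) : Set where
    constructor swapIn
    field
      {a b}  : Fin n
      a∈     : a ∈ S
      b∈     : b ∈ S
      edge   : Edge X a b
      differ : colour (σ a) ≢ colour (σ b)
      at-a   : σ' a ≡ σ b
      at-b   : σ' b ≡ σ a
      fixed  : ∀ c → c ≢ a → c ≢ b → σ' c ≡ σ c

  SwapIn⇒FriendlySwap : ∀ {S σ σ'} → SwapIn S σ σ' → FriendlySwap X Y σ σ'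
  SwapIn⇒FriendlySwap (swapIn _ _ e d p q r) = _ , _ , e , colour⇒Edge d , p , q , r

  module _ {S : Subset n} where

    SwapIn-sym : ∀ {σ σ'} → SwapIn S σ σ' → SwapIn S σ' σ
    SwapIn-sym (swapIn a∈ b∈ e d p q r) =
      swapIn a∈ b∈ e (λ eq → d (trans (cong colour (sym q)) (trans (sym eq) (cong colour p))))
        (sym q) (sym p) (λ c c≢a c≢b → sym (r c c≢a c≢b))

    SwapIn-transpose : ∀ {σ σ'} (s : SwapIn S σ σ') → ∀ c → σ' c ≡ σ (transpose (SwapIn.a s) (SwapIn.b s) c)
    SwapIn-transpose {σ} (swapIn {a} {b} _ _ _ _ p q r) c with transposeView a b c
    ... | left  = trans p (cong σ (sym (transpose-left a b)))
    ... | right = trans q (cong σ (sym (transpose-right a b)))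
    ... | other u v = trans (r c u v) (cong σ (sym (transpose-other u v)))

    InImage-SwapIn : ∀ {σ σ' l} → SwapIn S σ σ' → InImage S σ l → InImage S σ' l
    InImage-SwapIn (swapIn {a} {b} a∈ b∈ _ _ p q r) (x , x∈ , refl) with transposeView a b x
    ... | left  = b , b∈ , q
    ... | right = a , a∈ , p
    ... | other u v = x , x∈ , r x u v

    InImage-Star : ∀ {σ τ l} → Star (SwapIn S) σ τ → InImage S σ l → InImage S τ l
    InImage-Star ε        i = i
    InImage-Star (s ◅ ss) i = InImage-Star ss (InImage-SwapIn s i)

    injective-Star : ∀ {σ τ} → Star (SwapIn S) σ τ → Injective _≡_ _≡_ σ → Injective _≡_ _≡_ τ
    injective-Star ε inj = inj
    injective-Star (s ◅ ss) inj = injective-Star ss λ {x} {y} eq →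
      transpose-injective _ _ (inj (trans (sym (SwapIn-transpose s x)) (trans eq (SwapIn-transpose s y))))

    recolour-edge : ∀ {a b} → EdgeIn X S a b → ∀ σ → ∃[ τ ] (Star (SwapIn S) σ τ ×
      (∀ c → colour (τ c) ≡ colour (σ (transpose a b c))))
    recolour-edge {a} {b} (a∈ , b∈ , e) σ with colour (σ a) ℕ.≟ colour (σ b)
    ... | no d = σ ∘ transpose a b ,
      swapIn a∈ b∈ e d (cong σ (transpose-left a b)) (cong σ (transpose-right a b))
        (λ c u v → cong σ (transpose-other u v)) ◅ ε , λ c → refl
    ... | yes eq = σ , ε , λ c → same c
      where
      same : ∀ c → colour (σ c) ≡ colour (σ (transpose a b c))
      same c with transposeView a b c
      ... | left  = trans eq (cong (colour ∘ σ) (sym (transpose-left a b)))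
      ... | right = trans (sym eq) (cong (colour ∘ σ) (sym (transpose-right a b)))
      ... | other u v = cong (colour ∘ σ) (sym (transpose-other u v))

    -- Induction on the walk: swap along its first edge, rearrange along the rest, then swap along
    -- the first edge again. On colours this conjugates a transposition; which person of a given
    -- colour ends up where is not controlled.
    recolour : ∀ {a b} → Star (EdgeIn X S) a b → ∀ σ → ∃[ τ ] (Star (SwapIn S) σ τ ×
      (∀ c → colour (τ c) ≡ colour (σ (transpose a b c))))
    recolour {a} ε σ = σ , ε , λ c → cong (colour ∘ σ) (sym (self c))
      where
      self : ∀ c → transpose a a c ≡ c
      self c with transposeView a a c
      ... | left = transpose-left a a
      ... | right = transpose-left a a
      ... | other u v = transpose-other u v
    -- A walk may revisit vertices, while the conjugation needs `a`, `a'` and `b` distinct, so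
    -- coincidences are settled first.
    recolour {a} {b} (_◅_ {j = a'} e es) σ with b ≟ a | b ≟ a'
    ... | yes refl | _ = recolour {b} ε σ
    ... | no _ | yes refl = recolour-edge e σ
    ... | no b≢a | no b≢a' with recolour-edge e σ
    ...   | τ₁ , s₁ , p₁ with recolour es τ₁
    ...     | τ₂ , s₂ , p₂ with recolour-edge e τ₂
    ...       | τ₃ , s₃ , p₃ = τ₃ , s₁ ◅◅ s₂ ◅◅ s₃ , λ c →
      trans (p₃ c) (trans (p₂ _) (trans (p₁ _)
        (cong (colour ∘ σ) (transpose-conjugate (Edge-irrefl X (proj₂ (proj₂ e))) b≢a b≢a' c))))

    abstract
      -- Targets are filled one at a time. Moving `p` to `t` may displace a later source, so the
      -- remaining sources are relabelled by the same transposition. The last component, that all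
      -- other vertices keep their colour, protects the targets already filled.
      place : ConnectedIn X S → ∀ {ts ps} → Pointwise (λ t p → t ∈ S × p ∈ S) ts ps →
        Unique ts → Unique ps → ∀ σ → ∃[ τ ] (Star (SwapIn S) σ τ ×
          Pointwise (λ t p → colour (τ t) ≡ colour (σ p)) ts ps ×
          (∀ q → q ∉ˡ ts → q ∉ˡ ps → colour (τ q) ≡ colour (σ q)))
      place conn [] _ _ σ = σ , ε , [] , λ _ _ _ → refl
      place conn {t ∷ ts} {p ∷ ps} ((t∈ , p∈) ∷ ins) (t∉ ∷ uts) (p∉ ∷ ups) σ
        with recolour (conn t∈ p∈) σ
      ... | σ₁ , s₁ , c₁ with place conn (move ins) uts
                                (Uniqueₚ.map⁺ (transpose-injective t p) ups) σ₁
        where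
        move : ∀ {ts ps} → Pointwise (λ t p → t ∈ S × p ∈ S) ts ps →
               Pointwise (λ t p → t ∈ S × p ∈ S) ts (map (transpose t p) ps)
        move [] = []
        move (_∷_ {y = q} (a , b) r) = (a , stays (transposeView t p q) b) ∷ move r
          where
          stays : ∀ {q} → TransposeView t p q → q ∈ S → transpose t p q ∈ S
          stays left _ = subst (_∈ S) (sym (transpose-left t p)) p∈
          stays right _ = subst (_∈ S) (sym (transpose-right t p)) t∈
          stays (other u v) q∈ = subst (_∈ S) (sym (transpose-other u v)) q∈
      ...   | τ , s₂ , c₂ , fix = τ , s₁ ◅◅ s₂ ,
                trans (fix t (λ t∈ts → All.lookup t∉ t∈ts refl) t∉') (trans (c₁ t) (cong (colour ∘ σ) (transpose-left t p)))
                  ∷ unmove _ c₂ ,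
                λ q q∉ts q∉ps → trans (fix q (q∉ts ∘ there) (q∉' q q∉ts q∉ps)) (trans (c₁ q)
                  (cong (colour ∘ σ) (transpose-other (q∉ts ∘ here) (q∉ps ∘ here))))
        where
        t∉' : t ∉ˡ map (transpose t p) ps
        t∉' t∈' with ∈-map⁻ (transpose t p) t∈'
        ... | q , q∈ , eq = All.lookup p∉ q∈ (transpose-injective t p (trans (transpose-right t p) eq))
        q∉' : ∀ q → q ∉ˡ t ∷ ts → q ∉ˡ p ∷ ps → q ∉ˡ map (transpose t p) ps
        q∉' q u v q∈' with ∈-map⁻ (transpose t p) q∈'
        ... | r , r∈ , eq = v (there (subst (_∈ˡ ps) (transpose-injective t p
                (trans (sym eq) (sym (transpose-other (u ∘ here) (v ∘ here))))) r∈))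
        unmove : ∀ {ts} qs → Pointwise (λ a b → colour (τ a) ≡ colour (σ₁ b)) ts (map (transpose t p) qs) →
                 Pointwise (λ a b → colour (τ a) ≡ colour (σ b)) ts qs
        unmove [] [] = []
        unmove (q ∷ qs) (e ∷ es) =
          trans e (trans (c₁ _) (cong (colour ∘ σ) (transpose-involutive t p q))) ∷ unmove qs es

  -- Reachability and exchangeability.

  _⟶_ : (Fin n → Fin n) → (Fin n → Fin n) → Set
  σ ⟶ τ = ∃[ ρ ] (Star (FriendlySwap X Y) σ ρ × (∀ c → ρ c ≡ τ c))

  Star⇒⟶ : ∀ {σ τ} → Star (FriendlySwap X Y) σ τ → σ ⟶ τ
  Star⇒⟶ ss = _ , ss , λ _ → refl

  -- Configurations are compared pointwise. A pointwise equal start affects only the data of the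
  -- first swap, or the end point if there is no swap.
  ⟶-respˡ : ∀ {σ σ' τ} → (∀ c → σ c ≡ σ' c) → σ ⟶ τ → σ' ⟶ τ
  ⟶-respˡ {σ' = σ'} eq (ρ , ε , eq') = σ' , ε , λ c → trans (sym (eq c)) (eq' c)
  ⟶-respˡ eq (ρ , (a , b , e , e' , p , q , r) ◅ ss , eq') = ρ ,
    (a , b , e , subst₂ (Edge Y) (eq a) (eq b) e' , trans p (eq b) , trans q (eq a) ,
      (λ c u v → trans (r c u v) (eq c))) ◅ ss , eq'

  ⟶-respʳ : ∀ {σ τ τ'} → (∀ c → τ c ≡ τ' c) → σ ⟶ τ → σ ⟶ τ'
  ⟶-respʳ eq (ρ , ss , eq') = ρ , ss , λ c → trans (eq' c) (eq c)

  ⟶-trans : ∀ {σ τ υ} → σ ⟶ τ → τ ⟶ υ → σ ⟶ υ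
  ⟶-trans (ρ , ss , eq) r with ⟶-respˡ (λ c → sym (eq c)) r
  ... | ρ' , ss' , eq' = ρ' , ss ◅◅ ss' , eq'

  FriendlySwap-sym : ∀ {σ σ'} → FriendlySwap X Y σ σ' → FriendlySwap X Y σ' σ
  FriendlySwap-sym (a , b , e , e' , p , q , r) =
    a , b , e , Edge-sym Y (subst₂ (Edge Y) (sym q) (sym p) e') , sym q , sym p , λ c u v → sym (r c u v)

  module _ {i j : Fin n} (same : colour i ≡ colour j) where

    colour-transpose : ∀ l → colour (transpose i j l) ≡ colour l
    colour-transpose l with transposeView i j l
    ... | left  = trans (cong colour (transpose-left i j)) (sym same)
    ... | right = trans (cong colour (transpose-right i j)) same
    ... | other u v = cong colour (transpose-other u v)

    -- Interchanging two people of one class preserves every colour, hence is an automorphism of `Y`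
    -- and carries friendly swaps to friendly swaps.
    ⟶-transpose : ∀ {σ τ} → σ ⟶ τ → (transpose i j ∘ σ) ⟶ (transpose i j ∘ τ)
    ⟶-transpose (ρ , ss , eq) = _ , Star.gmap (transpose i j ∘_) relabel ss , λ c → cong (transpose i j) (eq c)
      where
      relabel : ∀ {σ τ} → FriendlySwap X Y σ τ → FriendlySwap X Y (transpose i j ∘ σ) (transpose i j ∘ τ)
      relabel (a , b , e , e' , p , q , r) =
        a , b , e ,
        colour⇒Edge (λ eq → Edge⇒colour e' (trans (sym (colour-transpose _)) (trans eq (colour-transpose _)))) ,
        cong (transpose i j) p , cong (transpose i j) q , λ c u v → cong (transpose i j) (r c u v)

    Exchangeable-back : ∀ {σ τ} → Star (FriendlySwap X Y) σ τ →
      Exchangeable X Y τ i j → Exchangeable X Y σ i j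
    Exchangeable-back ss exch = ⟶-trans (Star⇒⟶ ss)
      (⟶-trans exch (⟶-transpose (Star⇒⟶ (Star.reverse FriendlySwap-sym ss))))

  Exchangeable-sym : ∀ {σ i j} → Exchangeable X Y σ i j → Exchangeable X Y σ j i
  Exchangeable-sym {σ} {i} {j} = ⟶-respʳ (λ c → transpose-comm i j (σ c))

  -- (i k) = (i j)(j k)(i j).
  Exchangeable-trans : ∀ {σ i j k} → colour i ≡ colour j → colour j ≡ colour k →
    i ≢ j → k ≢ i → k ≢ j → Exchangeable X Y σ i j → Exchangeable X Y σ j k → Exchangeable X Y σ i k
  Exchangeable-trans {σ} ij jk i≢j k≢i k≢j e e' = ⟶-respʳ (λ c → transpose-conjugate i≢j k≢i k≢j (σ c))
    (⟶-trans e (⟶-trans (⟶-transpose ij e') (⟶-transpose ij (⟶-transpose jk e))))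

  -- Exchange at a vertex of degree at least three.

  module _ {S : Subset n} (J : Junction X S) where
    open Junction J

    private
      w≢x : w ≢ x
      w≢x = Edge-irrefl X wx
      w≢y : w ≢ y
      w≢y = Edge-irrefl X wy
      w≢z : w ≢ z
      w≢z = Edge-irrefl X wz

    module _ (σ : Fin n → Fin n) where

      -- The arguments are the people on `w`, `x`, `y`, `z` in this order, and `σ` rules elsewhere;
      -- a sequence of swaps at the junction becomes a sequence of four-letter words.
      layout : (A B P Q : Fin n) → Fin n → Fin n
      layout A B P Q c with c ≟ w | c ≟ x | c ≟ y | c ≟ z
      ... | yes _ | _ | _ | _ = A
      ... | no _ | yes _ | _ | _ = B
      ... | no _ | no _ | yes _ | _ = P
      ... | no _ | no _ | no _ | yes _ = Q
      ... | no _ | no _ | no _ | no _ = σ c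

      module _ {A B P Q : Fin n} where

        layout-w : layout A B P Q w ≡ A
        layout-w with w ≟ w
        ... | yes _ = refl
        ... | no w≢w = contradiction refl w≢w

        layout-x : layout A B P Q x ≡ B
        layout-x with x ≟ w | x ≟ x
        ... | yes x≡w | _ = contradiction (sym x≡w) w≢x
        ... | no _ | yes _ = refl
        ... | no _ | no x≢x = contradiction refl x≢x

        layout-y : layout A B P Q y ≡ P
        layout-y with y ≟ w | y ≟ x | y ≟ y
        ... | yes y≡w | _ | _ = contradiction (sym y≡w) w≢y
        ... | no _ | yes y≡x | _ = contradiction (sym y≡x) x≢y
        ... | no _ | no _ | yes _ = refl
        ... | no _ | no _ | no y≢y = contradiction refl y≢y

        layout-z : layout A B P Q z ≡ Q
        layout-z with z ≟ w | z ≟ x | z ≟ y | z ≟ z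
        ... | yes z≡w | _ | _ | _ = contradiction (sym z≡w) w≢z
        ... | no _ | yes z≡x | _ | _ = contradiction (sym z≡x) x≢z
        ... | no _ | no _ | yes z≡y | _ = contradiction (sym z≡y) y≢z
        ... | no _ | no _ | no _ | yes _ = refl
        ... | no _ | no _ | no _ | no z≢z = contradiction refl z≢z

        layout-unique : ∀ {τ : Fin n → Fin n} → τ w ≡ A → τ x ≡ B → τ y ≡ P → τ z ≡ Q →
          (∀ c → c ≢ w → c ≢ x → c ≢ y → c ≢ z → τ c ≡ σ c) → ∀ c → layout A B P Q c ≡ τ c
        layout-unique p q r s t c with c ≟ w | c ≟ x | c ≟ y | c ≟ z
        ... | yes refl | _ | _ | _ = sym p
        ... | no _ | yes refl | _ | _ = sym q
        ... | no _ | no _ | yes refl | _ = sym r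
        ... | no _ | no _ | no _ | yes refl = sym s
        ... | no i | no j | no k | no l = sym (t c i j k l)

      module _ {A B P Q : Fin n} where

        swap-wx : colour A ≢ colour B → layout A B P Q ⟶ layout B A P Q
        swap-wx d = Star⇒⟶ ((w , x , wx , colour⇒Edge (subst₂ (λ u v → colour u ≢ colour v) (sym layout-w) (sym layout-x) d) ,
          trans layout-w (sym layout-x) , trans layout-x (sym layout-w) , λ c → rest c) ◅ ε)
          where
          rest : ∀ c → c ≢ w → c ≢ x → layout B A P Q c ≡ layout A B P Q c
          rest c c≢w c≢x with c ≟ w | c ≟ x | c ≟ y | c ≟ z
          ... | yes e | _ | _ | _ = contradiction e c≢w
          ... | no _ | yes e | _ | _ = contradiction e c≢x
          ... | no _ | no _ | yes _ | _ = refl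
          ... | no _ | no _ | no _ | yes _ = refl
          ... | no _ | no _ | no _ | no _ = refl

        swap-wy : colour A ≢ colour P → layout A B P Q ⟶ layout P B A Q
        swap-wy d = Star⇒⟶ ((w , y , wy , colour⇒Edge (subst₂ (λ u v → colour u ≢ colour v) (sym layout-w) (sym layout-y) d) ,
          trans layout-w (sym layout-y) , trans layout-y (sym layout-w) , λ c → rest c) ◅ ε)
          where
          rest : ∀ c → c ≢ w → c ≢ y → layout P B A Q c ≡ layout A B P Q c
          rest c c≢w c≢y with c ≟ w | c ≟ x | c ≟ y | c ≟ z
          ... | yes e | _ | _ | _ = contradiction e c≢w
          ... | no _ | yes _ | _ | _ = refl
          ... | no _ | no _ | yes e | _ = contradiction e c≢y
          ... | no _ | no _ | no _ | yes _ = refl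
          ... | no _ | no _ | no _ | no _ = refl

        swap-wz : colour A ≢ colour Q → layout A B P Q ⟶ layout Q B P A
        swap-wz d = Star⇒⟶ ((w , z , wz , colour⇒Edge (subst₂ (λ u v → colour u ≢ colour v) (sym layout-w) (sym layout-z) d) ,
          trans layout-w (sym layout-z) , trans layout-z (sym layout-w) , λ c → rest c) ◅ ε)
          where
          rest : ∀ c → c ≢ w → c ≢ z → layout Q B P A c ≡ layout A B P Q c
          rest c c≢w c≢z with c ≟ w | c ≟ x | c ≟ y | c ≟ z
          ... | yes e | _ | _ | _ = contradiction e c≢w
          ... | no _ | yes _ | _ | _ = refl
          ... | no _ | no _ | yes _ | _ = refl
          ... | no _ | no _ | no _ | yes e = contradiction e c≢z
          ... | no _ | no _ | no _ | no _ = refl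

    -- The first six swaps rotate A and B through the arms y and z; they
    -- interchange P and Q as well, which the last three swaps undo.
    junction-exchange : ∀ σ → Injective _≡_ _≡_ σ →
      colour (σ w) ≡ colour (σ x) → colour (σ w) ≢ colour (σ y) → colour (σ w) ≢ colour (σ z) →
      colour (σ y) ≢ colour (σ z) → Exchangeable X Y σ (σ w) (σ x)
    junction-exchange σ inj wx= w≠y w≠z y≠z =
      ⟶-respˡ (layout-unique σ {τ = σ} refl refl refl refl (λ _ _ _ _ _ → refl))
      (⟶-respʳ (layout-unique σ {τ = transpose A B ∘ σ} (transpose-left A B) (transpose-right A B)
         (transpose-other (ne w≢y) (ne x≢y)) (transpose-other (ne w≢z) (ne x≢z))
         (λ c i j k l → transpose-other (i ∘ inj) (j ∘ inj)))
      (⟶-trans (swap-wy σ w≠y)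
      (⟶-trans (swap-wx σ (x≠y ∘ sym))
      (⟶-trans (swap-wz σ x≠z)
      (⟶-trans (swap-wy σ (w≠z ∘ sym))
      (⟶-trans (swap-wx σ w≠y)
      (⟶-trans (swap-wz σ (x≠y ∘ sym))
      (⟶-trans (swap-wy σ x≠z)
      (⟶-trans (swap-wz σ (y≠z ∘ sym))
      (swap-wy σ (x≠y ∘ sym)))))))))))
      where
      A = σ w
      B = σ x
      x≠y : colour (σ x) ≢ colour (σ y)
      x≠y = subst (_≢ colour (σ y)) wx= w≠y
      x≠z : colour (σ x) ≢ colour (σ z)
      x≠z = subst (_≢ colour (σ z)) wx= w≠z
      ne : ∀ {a b} → a ≢ b → σ b ≢ σ a
      ne a≢b eq = a≢b (sym (inj eq))

-- Lists without repetition and linked lists.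

module _ {A : Set} where

  -- The pigeonhole bound behind path lengths, class sizes and the size of `S`: each head of `xs` is
  -- cut out of `ys` at one occurrence.
  unique-⊆-length : ∀ {xs ys : List A} → Unique xs → (∀ {x} → x ∈ˡ xs → x ∈ˡ ys) → length xs ≤ length ys
  unique-⊆-length [] _ = z≤n
  unique-⊆-length {x ∷ xs} (x∉ ∷ u) sub with ∈-∃++ (sub (here refl))
  ... | as , bs , refl = subst (suc (length xs) ≤_) (sym (trans (length-++ as) (trans (ℕₚ.+-suc (length as) (length bs))
                           (cong suc (sym (length-++ as)))))) (s≤s (unique-⊆-length u sub'))
    where
    sub' : ∀ {y} → y ∈ˡ xs → y ∈ˡ as ++ bs
    sub' y∈ with ∈-++⁻ as (sub (there y∈))
    ... | inj₁ y∈as = ∈-++⁺ˡ y∈as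
    ... | inj₂ (here refl) = contradiction refl (All.lookup x∉ y∈)
    ... | inj₂ (there y∈bs) = ∈-++⁺ʳ as y∈bs

  linked-++⁻ˡ : ∀ {R : A → A → Set} xs {ys} → Linked R (xs ++ ys) → Linked R xs
  linked-++⁻ˡ [] _ = []
  linked-++⁻ˡ (x ∷ []) _ = [-]
  linked-++⁻ˡ (x ∷ y ∷ xs) (r ∷ rs) = r ∷ linked-++⁻ˡ (y ∷ xs) rs

  unique-++⁻ˡ : ∀ xs {ys : List A} → Unique (xs ++ ys) → Unique xs
  unique-++⁻ˡ [] _ = []
  unique-++⁻ˡ (x ∷ xs) (x∉ ∷ u) = Allₚ.++⁻ˡ xs x∉ ∷ unique-++⁻ˡ xs u

  linked-lookup : ∀ {R : A → A → Set} {x xs} → Linked R (x ∷ xs) →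
    ∀ i → R (lookup (x ∷ xs) (inject₁ i)) (lookup xs i)
  linked-lookup (r ∷ rs) zero = r
  linked-lookup (r ∷ rs@(_ ∷ _)) (suc i) = linked-lookup rs i

  lookup-injective : ∀ {xs : List A} → Unique xs → ∀ i j → lookup xs i ≡ lookup xs j → i ≡ j
  lookup-injective {_ ∷ _} _ zero zero _ = refl
  lookup-injective {_ ∷ _} (x∉ ∷ _) zero (suc j) eq = contradiction eq (All.lookup x∉ (∈-lookup j))
  lookup-injective {_ ∷ _} (x∉ ∷ _) (suc i) zero eq = contradiction (sym eq) (All.lookup x∉ (∈-lookup i))
  lookup-injective {_ ∷ _} (_ ∷ u) (suc i) (suc j) eq = cong suc (lookup-injective u i j eq)

  -- Shows that the two ends of a path with at least two vertices differ.
  reverse-head : ∀ {x x' y} xs {ys : List A} → reverse (x ∷ x' ∷ xs) ≡ y ∷ ys → y ∈ˡ x' ∷ xs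
  reverse-head {x} {x'} xs eq with reverse (x' ∷ xs) in eq' | unfold-reverse x (x' ∷ xs)
  ... | [] | _ = contradiction (trans (sym (length-reverse (x' ∷ xs))) (cong length eq')) λ ()
  ... | z ∷ zs | eq″ = Anyₚ.reverse⁻ (subst (_ ∈ˡ_) (sym eq') (here (∷-injectiveˡ (trans (sym eq) eq″))))

  lookup-last : ∀ x ys (u : A) → lookup (x ∷ ys ++ [ u ]) (fromℕ (length (ys ++ [ u ]))) ≡ u
  lookup-last x [] u = refl
  lookup-last x (y ∷ ys) u = lookup-last y ys u

  linked-reverse : ∀ {R : A → A → Set} → (∀ {x y} → R x y → R y x) →
    ∀ {xs} → Linked R xs → Linked R (reverse xs)
  linked-reverse {R} R-sym {[]} _ = []
  linked-reverse {R} R-sym {x ∷ xs} l = go xs l [-]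
    where
    go : ∀ {x zs} xs → Linked R (x ∷ xs) → Linked R (x ∷ zs) → Linked R (reverseAcc (x ∷ zs) xs)
    go [] _ r = r
    go (y ∷ xs) (e ∷ l) r = go xs l (R-sym e ∷ r)

  split-at : ∀ m (ws : List A) → 2 + m ≤ length ws →
    ∃[ ms ] ∃[ c ] ∃[ d ] ∃[ zs ] (length ms ≡ m × ws ≡ ms ++ c ∷ d ∷ zs)
  split-at zero (c ∷ d ∷ zs) _ = [] , c , d , zs , refl , refl
  split-at zero (_ ∷ []) (s≤s ())
  split-at (suc m) (w ∷ ws) (s≤s le) with split-at m ws le
  ... | ms , c , d , zs , refl , refl = w ∷ ms , c , d , zs , refl , refl

-- Bounded exhaustive search.

greatest : ∀ {Q : ℕ → Set} → Decidable Q → ∀ N → (∀ k → Q k → k ≤ N) → ∃ Q →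
  ∃[ k ] (Q k × ∀ j → Q j → j ≤ k)
greatest Q? N bound (k , q) with Q? N
... | yes qN = N , qN , bound
greatest Q? zero bound (k , q) | no ¬qN with bound k q
... | z≤n = contradiction q ¬qN
greatest {Q} Q? (suc N) bound w | no ¬qN = greatest Q? N bound' w
  where
  bound' : ∀ k → Q k → k ≤ N
  bound' k q with ℕₚ.m≤n⇒m<n∨m≡n (bound k q)
  ... | inj₁ (s≤s k≤N) = k≤N
  ... | inj₂ refl = contradiction q ¬qN

existsOfLength? : ∀ {n} {P : List (Fin n) → Set} → Decidable P →
  Decidable (λ k → ∃[ xs ] (length xs ≡ k × P xs))
existsOfLength? P? zero = map′ (λ p → [] , refl , p) (λ { ([] , _ , p) → p }) (P? [])
existsOfLength? P? (suc k) = map′ (λ { (x , xs , eq , p) → x ∷ xs , cong suc eq , p })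
  (λ { (x ∷ xs , eq , p) → x , xs , ℕₚ.suc-injective eq , p })
  (any? λ x → existsOfLength? (λ xs → P? (x ∷ xs)) k)

-- Deleting a vertex from a vertex set.

module _ {n : ℕ} where

  x∉p-x : ∀ {x : Fin n} {p} → x ∉ p - x
  x∉p-x = go _ _
    where
    go : ∀ {n} (x : Fin n) p → x ∉ p - x
    go zero (outside Vec.∷ p) ()
    go zero (inside Vec.∷ p) ()
    go (suc x) (_ Vec.∷ p) (Vec.there x∈) = go x p x∈

  x∈p-y⇒x∈p : ∀ {x y : Fin n} {p} → x ∈ p - y → x ∈ p
  x∈p-y⇒x∈p = p─q⊆p _ _

  x∈p-y⇒x≢y : ∀ {x y : Fin n} {p} → x ∈ p - y → x ≢ y
  x∈p-y⇒x≢y x∈ refl = x∉p-x x∈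

-- Paths, leaves and bridges of an induced subgraph.

module Paths {n : ℕ} (X : Graph n) where

  edge? : ∀ u v → Dec (Edge X u v)
  edge? u v = T? (Graph.Adj X u v)

  module _ (S : Subset n) where

    record Path (xs : List (Fin n)) : Set where
      constructor path
      field
        within : All (_∈ S) xs
        unique : Unique xs
        linked : Linked (Edge X) xs

    AtMostTwo : Fin n → Set
    AtMostTwo v = ∀ {x y z} → x ∈ S → y ∈ S → z ∈ S → Edge X v x → Edge X v y → Edge X v z →
      x ≢ y → x ≢ z → y ≢ z → ⊥

    -- b ∷ ms ++ [ c ] is a (2 + m)-bridge of the subgraph induced on S, with
    -- a and d witnessing that its end vertices are not leaves.
    NoBridge : ℕ → Set
    NoBridge m = ∀ {a b ms c d} → length ms ≡ m → Path (a ∷ b ∷ ms ++ c ∷ d ∷ []) → All AtMostTwo ms → ⊥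

    -- An isolated vertex counts as a leaf as well.
    Leaf : Fin n → Set
    Leaf l = ∀ {u v} → u ∈ S → v ∈ S → Edge X l u → Edge X l v → u ≡ v

    -- The vertex `q` is a second neighbour of `p`, so `p` is not a leaf.
    NonLeafNeighbour : Fin n → Fin n → Set
    NonLeafNeighbour v p = p ∈ S × Edge X v p × ∃[ q ] (q ∈ S × Edge X p q × q ≢ v)

    record Twig (l : Fin n) : Set where
      field
        member : l ∈ S
        leaf   : Leaf l
        stem   : ∀ {v p q} → v ∈ S → Edge X l v → NonLeafNeighbour v p → NonLeafNeighbour v q → p ≡ q

    Longest : List (Fin n) → Set
    Longest xs = Path xs × (∀ {ys} → Path ys → length ys ≤ length xs)

  module _ {S : Subset n} where

    path-tail : ∀ {x xs} → Path S (x ∷ xs) → Path S xs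
    path-tail (path (_ ∷ w) (_ ∷ u) [-]) = path w u []
    path-tail (path (_ ∷ w) (_ ∷ u) (_ ∷ l)) = path w u l

    path-prefix : ∀ xs {ys} → Path S (xs ++ ys) → Path S xs
    path-prefix xs (path w u l) = path (Allₚ.++⁻ˡ xs w) (unique-++⁻ˡ xs u) (linked-++⁻ˡ xs l)

    path-reverse : ∀ {xs} → Path S xs → Path S (reverse xs)
    path-reverse {xs} (path w u l) = path
      (All.tabulate (λ x∈ → All.lookup w (Anyₚ.reverse⁻ x∈)))
      (Permₛ.Unique-resp-↭ (setoid _) (↭⇒↭ₛ (↭-sym (↭-reverse xs))) u)
      (linked-reverse (Edge-sym X) l)

    path-cons : ∀ {x y xs} → x ∈ S → Edge X x y → x ∉ˡ y ∷ xs → Path S (y ∷ xs) → Path S (x ∷ y ∷ xs)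
    path-cons x∈ e x∉ (path w u l) = path (x∈ ∷ w) (Allₚ.¬Any⇒All¬ _ x∉ ∷ u) (e ∷ l)

    path? : Decidable (Path S)
    path? xs = map′ (λ { (w , u , l) → path w u l }) (λ { (path w u l) → w , u , l })
      (All.all? (_∈? S) xs ×-dec (UniqueDec.unique? _≟_ xs ×-dec linked? edge? xs))

    path-length : ∀ {xs} → Path S xs → length xs ≤ n
    path-length {xs} (path w u l) = subst (length xs ≤_) (length-tabulate id) (unique-⊆-length u (λ {x} _ → ∈-allFin x))

    -- abstract, so that with-abstractions do not unfold the exhaustive searches.
    abstract
      longest-path : ∀ {h} → h ∈ S → ∃ (Longest S)
      longest-path {h} h∈ with greatest (existsOfLength? path?) n (λ { k (xs , refl , p) → path-length p })
                                 (1 , h ∷ [] , refl , path (h∈ ∷ []) ([] ∷ []) [-])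
      ... | k , (xs , refl , p) , max = xs , p , λ {ys} q → max _ (ys , refl , q)

    longest-reverse : ∀ {xs} → Longest S xs → Longest S (reverse xs)
    longest-reverse {xs} (p , max) = path-reverse p , λ q → subst (_ ≤_) (sym (length-reverse xs)) (max q)

    -- A walk that enters a leaf must leave by the vertex it came from, so each such detour can be
    -- cut out.
    connected-remove : ∀ {l} → Leaf S l → ConnectedIn X S → ConnectedIn X (S - l)
    connected-remove {l} leaf conn u∈ v∈ =
      go (x∈p-y⇒x≢y u∈) (x∈p-y⇒x≢y v∈) (conn (x∈p-y⇒x∈p u∈) (x∈p-y⇒x∈p v∈))
      where
      go : ∀ {u v} → u ≢ l → v ≢ l → Star (EdgeIn X S) u v → Star (EdgeIn X (S - l)) u v
      go u≢l v≢l ε = ε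
      go u≢l v≢l (_◅_ {j = j} (u∈ , j∈ , e) es) with j ≟ l
      ... | no j≢l = (x∈p∧x≢y⇒x∈p-y u∈ u≢l , x∈p∧x≢y⇒x∈p-y j∈ j≢l , e) ◅ go j≢l v≢l es
      go u≢l v≢l ((u∈ , j∈ , e) ◅ ε) | yes refl = contradiction refl v≢l
      go u≢l v≢l ((u∈ , j∈ , e) ◅ (_ , k∈ , e') ◅ es) | yes refl
        with refl ← leaf u∈ k∈ (Edge-sym X e) e' = go u≢l v≢l es

    interior-neighbours : ∀ {a b v c d es} → Path S (a ∷ b ∷ v ∷ c ∷ d ∷ es) →
      ∃[ p ] ∃[ q ] (p ≢ q × NonLeafNeighbour S v p × NonLeafNeighbour S v q)
    interior-neighbours (path (a∈ ∷ b∈ ∷ v∈ ∷ c∈ ∷ d∈ ∷ _)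
                              ((_ ∷ a≢v ∷ _) ∷ (_ ∷ b≢c ∷ _) ∷ (_ ∷ v≢d ∷ _) ∷ _) (ab ∷ bv ∷ vc ∷ cd ∷ _)) =
      _ , _ , b≢c , (b∈ , Edge-sym X bv , _ , a∈ , Edge-sym X ab , a≢v) , (c∈ , vc , _ , d∈ , cd , v≢d ∘ sym)

    -- The neighbours of an inner vertex along the path continue to a further path vertex on either
    -- side, so neither is a leaf. Hence no twig hangs from an inner vertex.
    middle-neighbours : ∀ {a b} ms {c d v} → Path S (a ∷ b ∷ ms ++ c ∷ d ∷ []) → v ∈ˡ ms →
      ∃[ p ] ∃[ q ] (p ≢ q × NonLeafNeighbour S v p × NonLeafNeighbour S v q)
    middle-neighbours (_ ∷ []) p (here refl) = interior-neighbours p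
    middle-neighbours (_ ∷ _ ∷ []) p (here refl) = interior-neighbours p
    middle-neighbours (_ ∷ _ ∷ _ ∷ _) p (here refl) = interior-neighbours p
    middle-neighbours (m ∷ ms) p (there v∈) = middle-neighbours ms (path-tail p) v∈

    -- Deleting `l` can create a bridge only by lowering the degree of an inner vertex `v`, and then
    -- `l` hangs from `v`. But `v` has two distinct non-leaf neighbours on the path, against `stem`.
    noBridge-remove : ∀ {m l} → Twig S l → NoBridge S m → NoBridge (S - l) m
    noBridge-remove {m} {l} twig none {a} {b} {ms} {c} {d} eq p two =
      none eq p' (All.tabulate (λ v∈ → enlarge v∈ (All.lookup two v∈)))
      where
      open Twig twig
      larger : ∀ {xs} → Path (S - l) xs → Path S xs
      larger (path w u li) = path (All.map x∈p-y⇒x∈p w) u li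
      p' = larger p
      beside : ∀ {v} → v ∈ˡ ms → ¬ Edge X v l
      beside v∈ms vl with middle-neighbours ms p' v∈ms
      ... | _ , _ , p≢q , np , nq =
        p≢q (stem (All.lookup (Path.within p') (there (there (∈-++⁺ˡ v∈ms)))) (Edge-sym X vl) np nq)
      enlarge : ∀ {v} → v ∈ˡ ms → AtMostTwo (S - l) v → AtMostTwo S v
      enlarge {v} v∈ms two {x} {y} {z} x∈ y∈ z∈ vx vy vz x≢y x≢z y≢z with x ≟ l | y ≟ l | z ≟ l
      ... | no x≢l | no y≢l | no z≢l = two (x∈p∧x≢y⇒x∈p-y x∈ x≢l) (x∈p∧x≢y⇒x∈p-y y∈ y≢l)
                                           (x∈p∧x≢y⇒x∈p-y z∈ z≢l) vx vy vz x≢y x≢z y≢z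
      ... | yes refl | _ | _ = beside v∈ms vx
      ... | no _ | yes refl | _ = beside v∈ms vy
      ... | no _ | no _ | yes refl = beside v∈ms vz

    -- An inner vertex brings two neighbours on the path; with one neighbour off the path they make
    -- a junction.
    position : ∀ {xs u} → Path S xs → u ∈ˡ xs →
      (∃[ ys ] xs ≡ u ∷ ys) ⊎ (∃[ ys ] xs ≡ ys ++ [ u ]) ⊎
      ∃[ p ] ∃[ q ] (p ∈ˡ xs × q ∈ˡ xs × p ≢ q × Edge X u p × Edge X u q)
    position p (here refl) = inj₁ (_ , refl)
    position {x ∷ _} p (there u∈) with position (path-tail p) u∈
    ... | inj₁ ([] , refl) = inj₂ (inj₁ (x ∷ [] , refl))
    position (path _ ((_ ∷ x≢q ∷ _) ∷ _) (xu ∷ uq ∷ _)) (there u∈) | inj₁ (q ∷ _ , refl) =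
      inj₂ (inj₂ (_ , q , here refl , there (there (here refl)) , x≢q , Edge-sym X xu , uq))
    position {x ∷ _} p (there u∈) | inj₂ (inj₁ (ys , refl)) = inj₂ (inj₁ (x ∷ ys , refl))
    position p (there u∈) | inj₂ (inj₂ (p' , q , p∈ , q∈ , rest)) = inj₂ (inj₂ (p' , q , there p∈ , there q∈ , rest))

    exit-edge : ∀ {xs : List (Fin n)} {u v} → u ∈ˡ xs → v ∉ˡ xs → Star (EdgeIn X S) u v →
      ∃[ p ] ∃[ q ] (p ∈ˡ xs × q ∉ˡ xs × EdgeIn X S p q)
    exit-edge u∈ v∉ ε = contradiction u∈ v∉
    exit-edge {xs} u∈ v∉ (_◅_ {j = j} e es) with ∈ˡ-dec _≟_ j xs
    ... | yes j∈ = exit-edge j∈ v∉ es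
    ... | no j∉ = _ , _ , u∈ , j∉ , e

    abstract
      junction? : Dec (Junction X S)
      junction? = map′
        (λ { (w , x , y , z , (w∈ , x∈ , y∈ , z∈) , (wx , wy , wz) , x≢y , x≢z , y≢z) → record
             { w∈ = w∈ ; x∈ = x∈ ; y∈ = y∈ ; z∈ = z∈ ; wx = wx ; wy = wy ; wz = wz
             ; x≢y = x≢y ; x≢z = x≢z ; y≢z = y≢z } })
        unpack
        (any? λ w → any? λ x → any? λ y → any? λ z →
          (w ∈? S ×-dec (x ∈? S ×-dec (y ∈? S ×-dec z ∈? S))) ×-dec
          ((edge? w x ×-dec (edge? w y ×-dec edge? w z)) ×-dec
          (¬? (x ≟ y) ×-dec (¬? (x ≟ z) ×-dec ¬? (y ≟ z)))))
        where
        unpack : Junction X S → ∃[ w ] ∃[ x ] ∃[ y ] ∃[ z ] ((w ∈ S × x ∈ S × y ∈ S × z ∈ S) ×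
          (Edge X w x × Edge X w y × Edge X w z) × x ≢ y × x ≢ z × y ≢ z)
        unpack J = _ , _ , _ , _ , (w∈ , x∈ , y∈ , z∈) , (wx , wy , wz) , x≢y , x≢z , y≢z
          where
          open Junction J

  -- Longest paths in an acyclic graph.

  module _ (acyclic : ¬ HasCycle X) where

    close-cycle : ∀ {x y z zs} → Linked (Edge X) (x ∷ y ∷ z ∷ zs) → Unique (x ∷ y ∷ z ∷ zs) →
      ¬ Edge X (lookup (x ∷ y ∷ z ∷ zs) (fromℕ (suc (suc (length zs))))) x
    close-cycle {x} {y} {z} {zs} l u e =
      acyclic (length zs , lookup (x ∷ y ∷ z ∷ zs) , (λ {i} {j} → lookup-injective u i j) , linked-lookup l , e)

    close-path : ∀ {x y} ys {u} → Linked (Edge X) (x ∷ y ∷ ys ++ [ u ]) → Unique (x ∷ y ∷ ys ++ [ u ]) →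
      ¬ Edge X u x
    close-path {x} [] l u e = close-cycle l u e
    close-path {x} {y} (z ∷ ys) {u} l uq e =
      close-cycle l uq (subst (λ v → Edge X v x) (sym (lookup-last y (z ∷ ys) u)) e)

    module _ {S : Subset n} where

      -- The part of the path up to `u`, closed by the edge back to `x`, would be a cycle.
      no-chord : ∀ {x y ys u} → Path S (x ∷ y ∷ ys) → u ∈ˡ ys → ¬ Edge X x u
      no-chord {x} {y} p u∈ e with ∈-∃++ u∈
      ... | as , bs , refl with path-prefix {S} (x ∷ y ∷ as ++ [ _ ]) (subst (Path S) (cong (λ ws → x ∷ y ∷ ws) (sym (++-assoc as _ bs))) p)
      ...   | path _ uq l = close-path as l uq (Edge-sym X e)

      neighbour-on-path : ∀ {x xs u} → Path S (x ∷ xs) → u ∈ˡ xs → Edge X x u → ∃[ ys ] xs ≡ u ∷ ys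
      neighbour-on-path p (here refl) e = _ , refl
      neighbour-on-path p (there u∈) e = contradiction e (no-chord p u∈)

      -- A neighbour off the path would prolong it, and one beyond the second vertex would give a
      -- chord.
      longest-head-neighbour : ∀ {x xs u} → Longest S (x ∷ xs) → u ∈ S → Edge X x u → ∃[ ys ] xs ≡ u ∷ ys
      longest-head-neighbour {x} {xs} {u} (p , max) u∈ e with ∈ˡ-dec _≟_ u (x ∷ xs)
      ... | no u∉ = contradiction (max (path-cons u∈ (Edge-sym X e) u∉ p)) (ℕₚ.<⇒≱ ℕₚ.≤-refl)
      ... | yes (here refl) = contradiction refl (Edge-irrefl X e)
      ... | yes (there u∈xs) = neighbour-on-path p u∈xs e

      longest-head-leaf : ∀ {x xs} → Longest S (x ∷ xs) → Leaf S x
      longest-head-leaf long u∈ v∈ e e' with longest-head-neighbour long u∈ e | longest-head-neighbour long v∈ e'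
      ... | _ , refl | _ , refl = refl

      longest-head-twig : ∀ {x xs} → Longest S (x ∷ xs) → Twig S x
      longest-head-twig {x} {xs} long@(p , max) = record
        { member = All.lookup (Path.within p) (here refl)
        ; leaf = longest-head-leaf long
        ; stem = λ v∈ e np nq → same v∈ e np nq
        }
        where
        third : ∀ {v p ys} → xs ≡ v ∷ ys → v ∈ S → Edge X x v → NonLeafNeighbour S v p → ∃[ zs ] ys ≡ p ∷ zs
        third {v} {q} {ys} refl v∈ e (q∈ , vq , q' , q'∈ , qq' , q'≢v) with q ≟ x
        ... | yes refl = contradiction (longest-head-leaf long q'∈ v∈ qq' e) q'≢v
        ... | no q≢x with ∈ˡ-dec _≟_ q ys
        ...   | yes q∈ys = neighbour-on-path (path-tail p) q∈ys vq
        -- Exchanging the head `x` for `q` gives another longest path, so its head `q` has no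
        -- neighbour but `v`, against `q'`.
        ...   | no q∉ys with longest-head-neighbour (path-cons q∈ (Edge-sym X vq) q∉ (path-tail p) , max) q'∈ qq'
          where
          q∉ : q ∉ˡ v ∷ ys
          q∉ (here refl) = Edge-irrefl X vq refl
          q∉ (there q∈ys) = q∉ys q∈ys
        ...     | _ , refl = contradiction refl q'≢v
        same : ∀ {v p q} → v ∈ S → Edge X x v → NonLeafNeighbour S v p → NonLeafNeighbour S v q → p ≡ q
        same v∈ e np nq with longest-head-neighbour long v∈ e
        ... | ys , eq with third eq v∈ e np | third eq v∈ e nq
        ...   | _ , refl | _ , refl = refl

      abstract
        -- The first edge of a walk from `a` to `b` is a path of two vertices, so a longest path has
        -- two different ends; its reversal is longest too, and both heads are twigs.
        two-twigs : ConnectedIn X S → ∀ {a b} → a ∈ S → b ∈ S → a ≢ b →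
          ∃[ l ] ∃[ l' ] (l ≢ l' × Twig S l × Twig S l')
        two-twigs conn a∈ b∈ a≢b with longest-path a∈ | conn a∈ b∈
        ... | _ | ε = contradiction refl a≢b
        ... | xs , long@(p , max) | (a∈ , c∈ , e) ◅ _ =
          ends xs long (max (path (a∈ ∷ c∈ ∷ []) ((Edge-irrefl X e ∷ []) ∷ [] ∷ []) (e ∷ [-])))
          where
          ends : ∀ xs → Longest S xs → 2 ≤ length xs → ∃[ l ] ∃[ l' ] (l ≢ l' × Twig S l × Twig S l')
          ends xs long le with reverse xs in eq | longest-reverse long
          ends (x ∷ x' ∷ xs) long le | [] | _ = contradiction (trans (sym (length-reverse (x ∷ x' ∷ xs))) (cong length eq)) λ ()
          ends (_ ∷ []) _ (s≤s ()) | _ ∷ _ | _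
          ends (x ∷ x' ∷ xs) long@(path _ (x∉ ∷ _) _ , _) le | y ∷ ys | long' =
            x , y , All.lookup x∉ (reverse-head xs eq) , longest-head-twig long , longest-head-twig long'

      -- Otherwise some edge leaves the path. At either end it would prolong the path, the last
      -- vertex being treated by reversal; at an inner vertex it would give a junction.
      longest-covers : ConnectedIn X S → ¬ Junction X S → ∀ {xs u v} → Longest S xs → u ∈ˡ xs → v ∈ S → v ∈ˡ xs
      longest-covers conn ¬J {xs} {u} {v} long@(path w _ _ , _) u∈ v∈ with ∈ˡ-dec _≟_ v xs
      ... | yes v∈xs = v∈xs
      ... | no v∉ with exit-edge u∈ v∉ (conn (All.lookup w u∈) v∈)
      ...   | p , q , p∈ , q∉ , (p∈S , q∈S , e) with position (proj₁ long) p∈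
      ...     | inj₁ (ys , refl) with longest-head-neighbour long q∈S e
      ...       | _ , refl = contradiction (there (here refl)) q∉
      longest-covers conn ¬J long@(path w _ _ , _) u∈ v∈ | no v∉ | p , q , p∈ , q∉ , (p∈S , q∈S , e)
              | inj₂ (inj₁ (ys , refl))
        with longest-head-neighbour {p} {reverse ys} (subst (Longest S) (reverse-++ ys [ p ]) (longest-reverse long)) q∈S e
      ... | zs , eq = contradiction (∈-++⁺ˡ {xs = ys} (Anyₚ.reverse⁻ {xs = ys} (subst (q ∈ˡ_) (sym eq) (here refl)))) q∉
      longest-covers conn ¬J long@(path w _ _ , _) u∈ v∈ | no v∉ | p , q , p∈ , q∉ , (p∈S , q∈S , e)
              | inj₂ (inj₂ (x , y , x∈ , y∈ , x≢y , px , py)) = contradiction (record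
        { w∈ = p∈S ; x∈ = All.lookup w x∈ ; y∈ = All.lookup w y∈ ; z∈ = q∈S ; wx = px ; wy = py ; wz = e ; x≢y = x≢y
        ; x≢z = λ { refl → q∉ x∈ } ; y≢z = λ { refl → q∉ y∈ } }) ¬J

      abstract
        -- Without a junction a longest path covers `S`; its first `4 + m` vertices are then a
        -- bridge of `2 + m` vertices with one vertex beyond each end. The size of `S` is bounded
        -- through the lists that cover it.
        junction : ∀ {m u} → ConnectedIn X S → NoBridge S m → u ∈ S →
          (∀ xs → (∀ {v} → v ∈ S → v ∈ˡ xs) → 4 + m ≤ length xs) → Junction X S
        junction {m} conn none u∈ size with junction?
        ... | yes J = J
        ... | no ¬J with longest-path u∈
        ...   | [] , _ , max = contradiction (max (path (u∈ ∷ []) ([] ∷ []) [-])) λ ()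
        ...   | xs@(x ∷ xs') , long@(p , _) with size xs (longest-covers conn ¬J long (here refl))
        junction {m} conn none u∈ size | no ¬J | x ∷ x' ∷ xs , long@(p , _) | s≤s (s≤s le) with split-at m xs le
        ... | ms , c , d , zs , eq , refl = contradiction
          (path-prefix (x ∷ x' ∷ ms ++ c ∷ d ∷ []) (subst (Path S) (cong (λ ws → x ∷ x' ∷ ws) (sym (++-assoc ms _ zs))) p))
          (λ p' → none eq p' (All.tabulate λ {v} v∈ x∈ y∈ z∈ vx vy vz x≢y x≢z y≢z → ¬J (record
            { w∈ = All.lookup (Path.within p') (there (there (∈-++⁺ˡ v∈)))
            ; x∈ = x∈ ; y∈ = y∈ ; z∈ = z∈ ; wx = vx ; wy = vy ; wz = vz ; x≢y = x≢y ; x≢z = x≢z ; y≢z = y≢z })))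

-- Induction for two people of one class.

module OneColour {n : ℕ} (X Y : Graph n) (colour : Fin n → ℕ)
  (colour⇒Edge : ∀ {u v} → colour u ≢ colour v → Edge Y u v)
  (Edge⇒colour : ∀ {u v} → Edge Y u v → colour u ≢ colour v)
  (acyclic : ¬ HasCycle X) (c : ℕ)
  {r s : Fin n} (r≢c : colour r ≢ c) (s≢c : colour s ≢ c) (r≢s : colour r ≢ colour s)
  {m : ℕ} {others : List (Fin n)} (others! : Unique others) (others≢c : All (λ l → colour l ≢ c) others)
  (many : 2 + m ≤ length others)
  where

  open Swapping X Y colour colour⇒Edge Edge⇒colour
  open Paths X

  inImage? : ∀ S σ l → Dec (InImage {n} S σ l)
  inImage? S σ l = any? λ a → a ∈? S ×-dec σ a ≟ l

  inImage-remove : ∀ {S : Subset n} {σ l a} → InImage S σ l → l ≢ σ a → InImage (S - a) σ l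
  inImage-remove {σ = σ} (b , b∈ , refl) l≢ = b , x∈p∧x≢y⇒x∈p-y b∈ (l≢ ∘ cong σ) , refl

  -- The induction invariant. `NoBridge S m` excludes bridges of `2 + m` vertices, the number that
  -- `many` compares with the people outside class `c`.
  record Arrangement (S : Subset n) (σ : Fin n → Fin n) : Set where
    field
      connected : ConnectedIn X S
      noBridge  : NoBridge S m
      injective : Injective _≡_ _≡_ σ
      contains  : ∀ {l} → colour l ≢ c → InImage S σ l

  ExchangeableWithin : Subset n → (Fin n → Fin n) → Set
  ExchangeableWithin S σ = ∀ {A B} → colour A ≡ c → colour B ≡ c → A ≢ B →
    InImage S σ A → InImage S σ B → Exchangeable X Y σ A B

  Third : Subset n → (Fin n → Fin n) → Fin n → Fin n → Set
  Third S σ A B = ∃[ C ] (colour C ≡ c × C ≢ A × C ≢ B × InImage S σ C)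

  colours-≢ : ∀ {u v} → colour u ≡ c → colour v ≢ c → u ≢ v
  colours-≢ u≡c v≢c refl = v≢c u≡c

  arrangement-move : ∀ {S σ τ} → Star (SwapIn S) σ τ → Arrangement S σ → Arrangement S τ
  arrangement-move ss arr = record
    { connected = connected
    ; noBridge = noBridge
    ; injective = injective-Star ss injective
    ; contains = λ l≢c → InImage-Star ss (contains l≢c)
    }
    where
    open Arrangement arr

  arrangement-remove : ∀ {S σ l} → Twig S l → colour (σ l) ≡ c → Arrangement S σ → Arrangement (S - l) σ
  arrangement-remove {l = l} twig eq arr = record
    { connected = connected-remove (Twig.leaf twig) connected
    ; noBridge = noBridge-remove twig noBridge
    ; injective = injective
    ; contains = λ l≢c → inImage-remove (contains l≢c) (colours-≢ eq l≢c ∘ sym)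
    }
    where
    open Arrangement arr

  preimages-≢ : ∀ {σ : Fin n → Fin n} {a b A B} → σ a ≡ A → σ b ≡ B → A ≢ B → a ≢ b
  preimages-≢ refl refl A≢B refl = A≢B refl

  module _ {S : Subset n} {σ : Fin n → Fin n} (arr : Arrangement S σ) {A B : Fin n}
    (A≡c : colour A ≡ c) (B≡c : colour B ≡ c) (A≢B : A ≢ B)
    {a b : Fin n} (a∈ : a ∈ S) (σa : σ a ≡ A) (b∈ : b ∈ S) (σb : σ b ≡ B) where

    open Arrangement arr

    private
      A∈ : InImage S σ A
      A∈ = a , a∈ , σa
      B∈ : InImage S σ B
      B∈ = b , b∈ , σb

    exchange-two : ¬ Third S σ A B → Exchangeable X Y σ A B
    exchange-two ¬third
      with p , p∈ , σp ← contains r≢c | q , q∈ , σq ← contains s≢c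
      = go
      where
      size : ∀ xs → (∀ {v} → v ∈ S → v ∈ˡ xs) → 4 + m ≤ length xs
      -- `A`, `B` and `others` are distinct people who all stand in `S`, so `S` has at least
      -- `2 + (2 + m)` vertices.
      size xs covers = ℕₚ.≤-trans (s≤s (s≤s many)) (subst (2 + length others ≤_) (length-map σ xs)
        (unique-⊆-length ((A≢B ∷ All.map (colours-≢ A≡c) others≢c) ∷ All.map (colours-≢ B≡c) others≢c ∷ others!) sub))
        where
        on : ∀ {l} → InImage S σ l → l ∈ˡ map σ xs
        on (v , v∈ , refl) = ∈-map⁺ σ (covers v∈)
        sub : ∀ {l} → l ∈ˡ A ∷ B ∷ others → l ∈ˡ map σ xs
        sub (here refl) = on A∈
        sub (there (here refl)) = on B∈
        sub (there (there l∈)) = on (contains (All.lookup others≢c l∈))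
      J : Junction X S
      J = junction acyclic connected noBridge a∈ size
      open Junction J
      -- `place` controls colours only. With no third pebble in `S`, the pebbles brought to `w` and
      -- `x` must still be `A` and `B` in some order.
      only : ∀ {l} → colour l ≡ c → InImage S σ l → l ≡ A ⊎ l ≡ B
      only {l} l≡c l∈ with l ≟ A | l ≟ B
      ... | yes e | _ = inj₁ e
      ... | no _ | yes e = inj₂ e
      ... | no l≢A | no l≢B = contradiction (l , l≡c , l≢A , l≢B , l∈) ¬third
      go : Exchangeable X Y σ A B
      go with place connected
                ((w∈ , a∈) ∷ (x∈ , b∈) ∷ (y∈ , p∈) ∷ (z∈ , q∈) ∷ [])
                ((Edge-irrefl X wx ∷ Edge-irrefl X wy ∷ Edge-irrefl X wz ∷ []) ∷ (x≢y ∷ x≢z ∷ []) ∷ (y≢z ∷ []) ∷ [] ∷ [])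
                ((preimages-≢ σa σb A≢B ∷ preimages-≢ σa σp (colours-≢ A≡c r≢c) ∷ preimages-≢ σa σq (colours-≢ A≡c s≢c) ∷ [])
                  ∷ (preimages-≢ σb σp (colours-≢ B≡c r≢c) ∷ preimages-≢ σb σq (colours-≢ B≡c s≢c) ∷ [])
                  ∷ (preimages-≢ σp σq (r≢s ∘ cong colour) ∷ []) ∷ [] ∷ [])
                σ
      ... | τ , ss , (cw ∷ cx ∷ cy ∷ cz ∷ []) , _ =
        Exchangeable-back (trans A≡c (sym B≡c)) (Star.map SwapIn⇒FriendlySwap ss) conclude
        where
        τw≡c : colour (τ w) ≡ c
        τw≡c = trans cw (trans (cong colour σa) A≡c)
        τx≡c : colour (τ x) ≡ c
        τx≡c = trans cx (trans (cong colour σb) B≡c)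
        τy≡ : colour (τ y) ≡ colour r
        τy≡ = trans cy (cong colour σp)
        τz≡ : colour (τ z) ≡ colour s
        τz≡ = trans cz (cong colour σq)
        back : ∀ {v} → v ∈ S → InImage S σ (τ v)
        back v∈ = InImage-Star (Star.reverse SwapIn-sym ss) (_ , v∈ , refl)
        wx-exchange : Exchangeable X Y τ (τ w) (τ x)
        wx-exchange = junction-exchange J τ (injective-Star ss injective)
          (trans τw≡c (sym τx≡c))
          (λ e → r≢c (trans (sym τy≡) (trans (sym e) τw≡c)))
          (λ e → s≢c (trans (sym τz≡) (trans (sym e) τw≡c)))
          (λ e → r≢s (trans (sym τy≡) (trans e τz≡)))
        w≢x : τ w ≢ τ x
        w≢x e = Edge-irrefl X wx (injective-Star ss injective e)
        conclude : Exchangeable X Y τ A B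
        conclude with only τw≡c (back w∈) | only τx≡c (back x∈)
        ... | inj₁ e | inj₁ e' = contradiction (trans e (sym e')) w≢x
        ... | inj₂ e | inj₂ e' = contradiction (trans e (sym e')) w≢x
        ... | inj₁ e | inj₂ e' = subst₂ (Exchangeable X Y τ) e e' wx-exchange
        ... | inj₂ e | inj₁ e' = Exchangeable-sym (subst₂ (Exchangeable X Y τ) e e' wx-exchange)

    exchange-three : Third S σ A B →
      (∀ {τ l} → l ∈ S → Arrangement (S - l) τ → ExchangeableWithin (S - l) τ) → Exchangeable X Y σ A B
    exchange-three (C , C≡c , C≢A , C≢B , C∈) ih
      with l , l' , l≢l' , twig , twig' ← two-twigs acyclic connected a∈ b∈ (preimages-≢ σa σb A≢B)
      with place connected ((Twig.member twig , a∈) ∷ (Twig.member twig' , b∈) ∷ [])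
                 ((l≢l' ∷ []) ∷ [] ∷ []) ((preimages-≢ σa σb A≢B ∷ []) ∷ [] ∷ []) σ
    ... | τ , ss , (cl ∷ cl' ∷ []) , _ =
      Exchangeable-back (trans A≡c (sym B≡c)) (Star.map SwapIn⇒FriendlySwap ss) conclude
      where
      avoiding : ∀ {l} → Twig S l → colour (τ l) ≡ c → ∀ {U V} → colour U ≡ c → colour V ≡ c → U ≢ V →
        InImage S σ U → InImage S σ V → U ≢ τ l → V ≢ τ l → Exchangeable X Y τ U V
      avoiding twig eq U≡c V≡c U≢V U∈ V∈ U≢ V≢ =
        ih (Twig.member twig) (arrangement-remove twig eq (arrangement-move ss arr)) U≡c V≡c U≢V
          (inImage-remove (InImage-Star ss U∈) U≢) (inImage-remove (InImage-Star ss V∈) V≢)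
      avoiding-l = avoiding twig (trans cl (trans (cong colour σa) A≡c))
      avoiding-l' = avoiding twig' (trans cl' (trans (cong colour σb) B≡c))
      Z≢Z' : τ l ≢ τ l'
      Z≢Z' e = l≢l' (injective-Star ss injective e)
      via-C : Exchangeable X Y τ A C → Exchangeable X Y τ C B → Exchangeable X Y τ A B
      via-C = Exchangeable-trans (trans A≡c (sym C≡c)) (trans C≡c (sym B≡c)) (C≢A ∘ sym) (A≢B ∘ sym) (C≢B ∘ sym)
      conclude : Exchangeable X Y τ A B
      -- The pebbles on `l` and `l'` need not be `A` and `B`. If one end carries neither, it can be
      -- deleted. Otherwise `A` and `B` occupy both ends and `C` neither, so each of them is
      -- exchanged with `C` after deleting the end where the other stands.
      conclude with A ≟ τ l | B ≟ τ l | A ≟ τ l' | B ≟ τ l'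
      ... | no p | no q | _ | _ = avoiding-l A≡c B≡c A≢B A∈ B∈ p q
      ... | _ | _ | no p | no q = avoiding-l' A≡c B≡c A≢B A∈ B∈ p q
      ... | yes e | yes e' | _ | _ = contradiction (trans e (sym e')) A≢B
      ... | _ | _ | yes e | yes e' = contradiction (trans e (sym e')) A≢B
      ... | yes e | _ | yes e' | _ = contradiction (trans (sym e) e') Z≢Z'
      ... | _ | yes e | _ | yes e' = contradiction (trans (sym e) e') Z≢Z'
      ... | yes refl | no q | no q' | yes refl =
        via-C (avoiding-l' A≡c C≡c (C≢A ∘ sym) A∈ C∈ A≢B C≢B) (avoiding-l C≡c B≡c C≢B C∈ B∈ C≢A (A≢B ∘ sym))
      ... | no q | yes refl | yes refl | no q' =
        via-C (avoiding-l A≡c C≡c (C≢A ∘ sym) A∈ C∈ A≢B C≢B) (avoiding-l' C≡c B≡c C≢B C∈ B∈ C≢A (A≢B ∘ sym))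

  abstract
    third? : ∀ S σ A B → Dec (Third S σ A B)
    third? S σ A B = any? λ C → colour C ℕ.≟ c ×-dec (¬? (C ≟ A) ×-dec (¬? (C ≟ B) ×-dec inImage? S σ C))

  exchange-within : ∀ k {S σ} → ∣ S ∣ ≤ k → Arrangement S σ → ExchangeableWithin S σ
  exchange-within zero le arr _ _ _ (a , a∈ , _) _ =
    contradiction (ℕₚ.≤-trans (x∈p⇒∣p-x∣<∣p∣ a∈) le) λ ()
  exchange-within (suc k) {S} {σ} le arr {A} {B} A≡c B≡c A≢B (a , a∈ , σa) (b , b∈ , σb) with third? S σ A B
  ... | no ¬third = exchange-two arr A≡c B≡c A≢B a∈ σa b∈ σb ¬third
  ... | yes third = exchange-three arr A≡c B≡c A≢B a∈ σa b∈ σb third λ l∈ arr' →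
    exchange-within k (ℕₚ.≤-pred (ℕₚ.≤-trans (x∈p⇒∣p-x∣<∣p∣ l∈) le)) arr'

-- Loop erasure of walks.

module _ {A : Set} {R : A → A → Set} where

  drop-to : ∀ xs {u b : A} → u ∈ˡ xs ++ [ b ] → u ≢ b → Linked R (xs ++ [ b ]) → Unique (xs ++ [ b ]) →
    ∃[ ys ] (Linked R (u ∷ ys ++ [ b ]) × Unique (u ∷ ys ++ [ b ]))
  drop-to [] (here refl) u≢b _ _ = contradiction refl u≢b
  drop-to (x ∷ xs) (here refl) _ l u = xs , l , u
  drop-to (x ∷ xs) (there u∈) u≢b l (_ ∷ u) = drop-to xs u∈ u≢b (Linked.tail l) u

-- Links cut-edges, defined by walks, with acyclicity, which concerns cycles without repeated
-- vertices. If `a` recurs on the erased remainder, the part before it is dropped.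
loop-erase : ∀ {n} {R : Fin n → Fin n → Set} {a b} → Star R a b → a ≢ b →
  ∃[ ys ] (Linked R (a ∷ ys ++ [ b ]) × Unique (a ∷ ys ++ [ b ]))
loop-erase ε a≢b = contradiction refl a≢b
loop-erase {a = a} {b} (_◅_ {j = c} r rs) a≢b with c ≟ b
... | yes refl = [] , r ∷ [-] , (a≢b ∷ []) ∷ [] ∷ []
... | no c≢b with loop-erase rs c≢b
...   | ys , l , u with ∈ˡ-dec _≟_ a (c ∷ ys ++ [ b ])
...     | yes a∈ = drop-to (c ∷ ys) a∈ a≢b l u
...     | no a∉ = c ∷ ys , r ∷ l , Allₚ.¬Any⇒All¬ _ a∉ ∷ u

-- Degrees and bridges of the whole graph.

lookup-inner : ∀ {A : Set} (b : A) ms {c} (j : Fin (suc (length (ms ++ [ c ])))) →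
  j ≢ zero → j ≢ fromℕ (length (ms ++ [ c ])) → lookup (b ∷ ms ++ [ c ]) j ∈ˡ ms
lookup-inner b _ zero j≢0 _ = contradiction refl j≢0
lookup-inner b [] (suc zero) _ j≢l = contradiction refl j≢l
lookup-inner b (m ∷ ms) (suc zero) _ _ = here refl
lookup-inner b (m ∷ ms) (suc (suc j)) _ j≢l = there (lookup-inner m ms (suc j) (λ ()) (j≢l ∘ cong suc))

module _ {n : ℕ} (X : Graph n) where
  open Paths X

  neighbours : Fin n → List (Fin n)
  neighbours v = filter (edge? v) (allFin n)

  neighbours! : ∀ v → Unique (neighbours v)
  neighbours! v = Uniqueₚ.filter⁺ (edge? v) (Uniqueₚ.allFin⁺ n)

  ∈-neighbours : ∀ {v u} → Edge X v u → u ∈ˡ neighbours v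
  ∈-neighbours {v} {u} e = ∈-filter⁺ (edge? v) (∈-allFin u) e

  neighbours-edges : ∀ v → All (Edge X v) (neighbours v)
  neighbours-edges v = Allₚ.all-filter (edge? v) (allFin n)

  degree-neighbours : ∀ v → degree X v ≡ length (neighbours v)
  degree-neighbours v = go (allFin n)
    where
    go : ∀ xs → sum (map (λ u → if Graph.Adj X v u then 1 else 0) xs) ≡ length (filter (edge? v) xs)
    go [] = refl
    go (x ∷ xs) with Graph.Adj X v x
    ... | true = cong suc (go xs)
    ... | false = go xs

  TwoNeighbours : Fin n → Set
  TwoNeighbours v = ∃[ p ] ∃[ q ] (p ≢ q × Edge X v p × Edge X v q)

  degree≢1 : ∀ {v} → TwoNeighbours v → degree X v ≢ 1
  degree≢1 {v} (p , q , p≢q , vp , vq) eq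
    with neighbours v | degree-neighbours v | ∈-neighbours vp | ∈-neighbours vq
  ... | [] | eq' | _ | _ = contradiction (trans (sym eq') eq) λ ()
  ... | x ∷ [] | eq' | here refl | here refl = p≢q refl
  ... | x ∷ y ∷ _ | eq' | _ | _ = contradiction (trans (sym eq') eq) λ ()

  degree≡2 : ∀ {v} → TwoNeighbours v → AtMostTwo ⊤ v → degree X v ≡ 2
  degree≡2 {v} two@(p , q , p≢q , vp , vq) most with neighbours v | degree-neighbours v | ∈-neighbours vp | neighbours! v | neighbours-edges v
  ... | x ∷ [] | eq | _ | _ | _ = contradiction eq (degree≢1 two)
  ... | x ∷ y ∷ [] | eq | _ | _ | _ = eq
  ... | x ∷ y ∷ z ∷ _ | _ | _ | (x≢y ∷ x≢z ∷ _) ∷ (y≢z ∷ _) ∷ _ | vx ∷ vy ∷ vz ∷ _ =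
    contradiction y≢z (most ∈⊤ ∈⊤ ∈⊤ vx vy vz x≢y x≢z)

  path-two-neighbours : ∀ {S a} ys {d v} → Path S (a ∷ ys ++ [ d ]) → v ∈ˡ ys → TwoNeighbours v
  path-two-neighbours (v ∷ []) (path _ ((_ ∷ a≢d ∷ _) ∷ _) (av ∷ vd ∷ _)) (here refl) = _ , _ , a≢d , Edge-sym X av , vd
  path-two-neighbours (v ∷ y ∷ ys) (path _ ((_ ∷ a≢y ∷ _) ∷ _) (av ∷ vy ∷ _)) (here refl) = _ , _ , a≢y , Edge-sym X av , vy
  path-two-neighbours (y ∷ ys) p (there v∈) = path-two-neighbours ys (path-tail p) v∈

  -- `IsBridge` unfolds only at a visible successor, which `length (ms ++ [ c ])` is not; `0 < l`
  -- stands in for it.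
  isBridge-intro : ∀ {l} {p : Fin (suc l) → Fin n} → 0 < l → (∀ i → CutEdge X (p (inject₁ i)) (p (suc i))) →
    (∀ j → j ≢ zero → j ≢ fromℕ l → degree X (p j) ≡ 2) → degree X (p zero) ≢ 1 → degree X (p (fromℕ l)) ≢ 1 →
    IsBridge X l p
  isBridge-intro {suc l} _ cut two first last = cut , two , first , last

  module _ (acyclic : ¬ HasCycle X) where

    -- A walk avoiding the edge, once freed of loops, would close up with the edge to a cycle.
    edge⇒cutEdge : ∀ {a b} → Edge X a b → CutEdge X a b
    edge⇒cutEdge {a} {b} e = e , λ walk → separated (loop-erase walk (Edge-irrefl X e))
      where
      separated : ¬ (∃[ ys ] (Linked (EdgeMinus X a b) (a ∷ ys ++ [ b ]) × Unique (a ∷ ys ++ [ b ])))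
      -- A path of a single step would be the deleted edge itself.
      separated ([] , (_ , ¬ab) ∷ _ , _) = ¬ab (inj₁ (refl , refl))
      separated (y ∷ ys , l , u) = close-path acyclic ys (Linked.map proj₁ l) u (Edge-sym X e)

    -- Acyclicity makes every edge a cut-edge, and the outer vertices `a` and `d` give `b` and `c` a
    -- second neighbour, so the stretch from `b` to `c` would be a bridge.
    noBridge-⊤ : ∀ {m} → ¬ HasBridge X (2 + m) → NoBridge ⊤ m
    noBridge-⊤ {m} ¬bridge {a} {b} {ms} {c} {d} eq p two =
      ¬bridge (length (ms ++ [ c ]) , cong suc (trans (length-++ ms) (trans (ℕₚ.+-comm (length ms) 1) (cong suc eq))) ,
        vertices , ((λ {i} {j} → lookup-injective (Path.unique bridge) i j) , edges) ,
        isBridge-intro (∈-length (∈-++⁺ʳ ms (here refl))) (λ i → edge⇒cutEdge (edges i))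
          (λ j j≢0 j≢l → degree≡2 (two-neighbours j) (All.lookup two (lookup-inner b ms j j≢0 j≢l)))
          (degree≢1 (two-neighbours zero)) (degree≢1 (two-neighbours (fromℕ _))))
      where
      longer : Path ⊤ (a ∷ (b ∷ ms ++ [ c ]) ++ [ d ])
      longer = subst (λ ws → Path ⊤ (a ∷ b ∷ ws)) (sym (++-assoc ms [ c ] [ d ])) p
      bridge : Path ⊤ (b ∷ ms ++ [ c ])
      bridge = path-prefix (b ∷ ms ++ [ c ]) (path-tail longer)
      vertices : Fin (suc (length (ms ++ [ c ]))) → Fin n
      vertices = lookup (b ∷ ms ++ [ c ])
      edges : ∀ i → Edge X (vertices (inject₁ i)) (vertices (suc i))
      edges = linked-lookup (Path.linked bridge)
      two-neighbours : ∀ j → TwoNeighbours (vertices j)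
      two-neighbours j = path-two-neighbours (b ∷ ms ++ [ c ]) longer (∈-lookup j)

-- Classes as consecutive blocks, and their sizes.

class-interval : ∀ {s} (k : Fin (suc s) → ℕ) c → ∃[ o ] ∃[ j ] (∀ v → v < sum (tabulate k) →
  partOf v (tabulate k) ≡ c → o ≤ v × v < o + k j)
class-interval k zero = 0 , zero , first
  where
  first : ∀ v → v < sum (tabulate k) → partOf v (tabulate k) ≡ 0 → 0 ≤ v × v < k zero
  first v _ eq with v <ᵇ k zero in lt
  ... | true = z≤n , ℕₚ.<ᵇ⇒< v _ (subst T (sym lt) tt)
-- For `c` past the last class the last block is returned; the bounds follow from `v<` alone.
class-interval {zero} k (suc c) = 0 , zero , none
  where
  none : ∀ v → v < sum (tabulate k) → partOf v (tabulate k) ≡ suc c → 0 ≤ v × v < k zero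
  none v v< _ = z≤n , subst (v <_) (ℕₚ.+-identityʳ (k zero)) v<
class-interval {suc s} k (suc c) with class-interval (k ∘ suc) c
... | o , j , within = k zero + o , suc j , later
  where
  later : ∀ v → v < sum (tabulate k) → partOf v (tabulate k) ≡ suc c → k zero + o ≤ v × v < k zero + o + k (suc j)
  later v v< eq with v <ᵇ k zero in lt
  later v v< () | true
  later v v< eq | false with ℕₚ.≮⇒≥ {v} {k zero} (λ v<k → subst T lt (ℕₚ.<⇒<ᵇ v<k))
  ... | k≤v with within (v ∸ k zero) (ℕₚ.+-cancelˡ-< (k zero) _ _ (subst (_< sum (tabulate k)) (sym (ℕₚ.m+[n∸m]≡n k≤v)) v<)) (ℕₚ.suc-injective eq)
  ...   | lo , hi = subst (k zero + o ≤_) (ℕₚ.m+[n∸m]≡n k≤v) (ℕₚ.+-monoʳ-≤ (k zero) lo) ,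
      subst₂ _<_ (ℕₚ.m+[n∸m]≡n k≤v) (sym (ℕₚ.+-assoc (k zero) o _)) (ℕₚ.+-monoʳ-< (k zero) hi)

-- The witness is the first vertex of block `j`, which positivity makes nonempty.
class-member : ∀ {s} (k : Fin s → ℕ) → (∀ i → 1 ≤ k i) → (j : Fin s) →
  ∃[ v ] (v < sum (tabulate k) × partOf v (tabulate k) ≡ toℕ j)
class-member k pos zero with k zero | pos zero
... | suc k₀ | _ = 0 , s≤s z≤n , refl
class-member k pos (suc j) with class-member (k ∘ suc) (pos ∘ suc) j
... | v , v< , eq = k zero + v , ℕₚ.+-monoʳ-< (k zero) v< , shifted
  where
  shifted : partOf (k zero + v) (tabulate k) ≡ suc (toℕ j)
  shifted with k zero + v <ᵇ k zero in lt
  ... | true = contradiction (ℕₚ.<ᵇ⇒< _ _ (subst T (sym lt) tt)) (ℕₚ.m+n≮m (k zero) v)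
  ... | false = cong suc (trans (cong (λ u → partOf u (tabulate (k ∘ suc))) (ℕₚ.m+n∸m≡n (k zero) v)) eq)

term≤sum : ∀ {s} (k : Fin s → ℕ) i → k i ≤ sum (tabulate k)
term≤sum k zero = ℕₚ.m≤m+n _ _
term≤sum k (suc i) = ℕₚ.≤-trans (term≤sum (k ∘ suc) i) (ℕₚ.m≤n+m _ (k zero))

-- Here `t > 2` enters: at most one of the first three indices equals `c`.
two-others : ∀ {s} c → ∃[ i ] ∃[ j ] (toℕ {suc (suc (suc s))} i ≢ c × toℕ {suc (suc (suc s))} j ≢ c × toℕ i ≢ toℕ j)
two-others zero = suc zero , suc (suc zero) , (λ ()) , (λ ()) , λ ()
two-others (suc zero) = zero , suc (suc zero) , (λ ()) , (λ ()) , λ ()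
two-others (suc (suc c)) = zero , suc zero , (λ ()) , (λ ()) , λ ()

module _ (n : ℕ) (ks : List ℕ) where

  part : Fin n → ℕ
  part v = partOf (toℕ v) ks

  part⇒Edge : ∀ {u v} → part u ≢ part v → Edge (CompleteMultipartite n ks) u v
  part⇒Edge {u} {v} u≢v with part u ≡ᵇ part v in eq
  ... | true = u≢v (ℕₚ.≡ᵇ⇒≡ _ _ (subst T (sym eq) tt))
  ... | false = tt

  Edge⇒part : ∀ {u v} → Edge (CompleteMultipartite n ks) u v → part u ≢ part v
  Edge⇒part {u} {v} e u≡v with part u ≡ᵇ part v in eq
  ... | false = subst T eq (ℕₚ.≡⇒≡ᵇ _ _ u≡v)

module Classes {s n : ℕ} (k : Fin (3 + s) → ℕ) (pos : ∀ i → 1 ≤ k i) (mono : ∀ i j → i F.≤ j → k i ≤ k j)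
  (n≡ : n ≡ sum (tabulate k)) (c : ℕ) where

  private
    p : Fin n → ℕ
    p = part n (tabulate k)

    kₜ : ℕ
    kₜ = k (fromℕ (2 + s))

    inClass? : ∀ v → Dec (p v ≡ c)
    inClass? v = p v ℕ.≟ c

    class : List (Fin n)
    class = filter inClass? (allFin n)

  others : List (Fin n)
  others = filter (¬? ∘ inClass?) (allFin n)

  others! : Unique others
  others! = Uniqueₚ.filter⁺ (¬? ∘ inClass?) (Uniqueₚ.allFin⁺ n)

  others≢c : All (λ v → p v ≢ c) others
  others≢c = Allₚ.all-filter (¬? ∘ inClass?) (allFin n)

  -- The class embeds in an interval of length `k t` for some `t`, and by `mono` no block is longer
  -- than the last.
  class-length : length class ≤ kₜ
  class-length with class-interval k c
  ... | o , t , within = ℕₚ.≤-trans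
      (subst₂ _≤_ (length-map toℕ class) (trans (length-map (o +_) (upTo (k t))) (length-upTo (k t)))
        (unique-⊆-length (Uniqueₚ.map⁺ toℕ-injective (Uniqueₚ.filter⁺ inClass? (Uniqueₚ.allFin⁺ n))) sub))
      (mono t _ (subst (toℕ t ≤_) (sym (toℕ-fromℕ (2 + s))) (ℕₚ.≤-pred (toℕ<n t))))
    where
    sub : ∀ {v} → v ∈ˡ map toℕ class → v ∈ˡ map (o +_) (upTo (k t))
    sub v∈ with ∈-map⁻ toℕ v∈
    ... | v , v∈class , refl
      with within (toℕ v) (subst (toℕ v <_) n≡ (toℕ<n v)) (proj₂ (∈-filter⁻ inClass? {xs = allFin n} v∈class))
    ...   | lo , hi = subst (_∈ˡ map (o +_) (upTo (k t))) (ℕₚ.m+[n∸m]≡n lo)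
            (∈-map⁺ (o +_) (∈-upTo⁺ (ℕₚ.+-cancelˡ-< o _ _ (subst (_< o + k t) (sym (ℕₚ.m+[n∸m]≡n lo)) hi))))

  others-length : n ∸ kₜ ≤ length others
  others-length = ℕₚ.m≤n+o⇒m∸n≤o n kₜ (ℕₚ.≤-trans cover (ℕₚ.+-monoˡ-≤ (length others) class-length))
    where
    split : ∀ v → v ∈ˡ class ++ others
    split v with inClass? v
    ... | yes v∈ = ∈-++⁺ˡ (∈-filter⁺ inClass? (∈-allFin v) v∈)
    ... | no v∉ = ∈-++⁺ʳ class (∈-filter⁺ (¬? ∘ inClass?) (∈-allFin v) v∉)
    cover : n ≤ length class + length others
    cover = subst₂ _≤_ (length-tabulate id) (length-++ class)
      (unique-⊆-length (Uniqueₚ.allFin⁺ n) (λ {v} _ → split v))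

  -- The first two classes are nonempty and the last class is a later one. This lets `n ∸ kₜ` be
  -- written as `2 + m`.
  two≤ : 2 ≤ n ∸ kₜ
  two≤ = ℕₚ.m+n≤o⇒m≤o∸n 2 (subst (2 + kₜ ≤_) (sym n≡)
    (ℕₚ.+-mono-≤ (pos zero) (ℕₚ.+-mono-≤ (pos (suc zero)) (term≤sum (λ i → k (suc (suc i))) (fromℕ s)))))

  representatives : ∃[ u ] ∃[ v ] (p u ≢ c × p v ≢ c × p u ≢ p v)
  representatives with two-others {s} c
  ... | t , t' , t≢c , t'≢c , t≢t' with member t | member t'
    where
    member : ∀ t → ∃[ v ] (p v ≡ toℕ t)
    member t with class-member k pos t
    ... | v , v< , eq = fromℕ< v<n , trans (cong (λ u → partOf u (tabulate k)) (toℕ-fromℕ< v<n)) eq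
      where
      v<n : v < n
      v<n = subst (v <_) (sym n≡) v<
  ...   | u , eq | v , eq' =
    u , v , t≢c ∘ trans (sym eq) , t'≢c ∘ trans (sym eq') , λ e → t≢t' (trans (sym eq) (trans e eq'))

-- Exchange of two people standing on adjacent vertices of the tree.

theorem5p1 : (s : ℕ) (k : Fin (suc s) → ℕ) (n : ℕ)
    → 2 < suc s
    → (∀ i → 1 ≤ k i)
    → (∀ i j → i F.≤ j → k i ≤ k j)
    → n ≡ sum (tabulate k)
    → 4 ≤ n
    → (X : Graph n) → IsTree X
    → ¬ HasBridge X (n ∸ k (fromℕ s))
    → (i j : Fin n) (σ : Permutation′ n)
    → Edge X (σ ⟨$⟩ˡ i) (σ ⟨$⟩ˡ j)
    → Exchangeable X (CompleteMultipartite n (tabulate k)) (σ ⟨$⟩ʳ_) i j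
theorem5p1 (suc (suc s)) k n (s≤s (s≤s (s≤s z≤n))) pos mono n≡ _ X (conn , acyclic) ¬bridge i j σ edge = proof
  where
  Y : Graph n
  Y = CompleteMultipartite n (tabulate k)

  p : Fin n → ℕ
  p = part n (tabulate k)

  open Classes k pos mono n≡ (p i)

  different : p i ≢ p j → Exchangeable X Y (σ ⟨$⟩ʳ_) i j
  -- People of different classes on adjacent vertices trade places in a single friendly swap.
  different i≢j = _ , (σ ⟨$⟩ˡ i , σ ⟨$⟩ˡ j , edge ,
      part⇒Edge n (tabulate k) (subst₂ (λ u v → p u ≢ p v) (sym (inverseʳ σ)) (sym (inverseʳ σ)) i≢j) ,
      trans (cong (transpose i j) (inverseʳ σ)) (trans (transpose-left i j) (sym (inverseʳ σ))) ,
      trans (cong (transpose i j) (inverseʳ σ)) (trans (transpose-right i j) (sym (inverseʳ σ))) ,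
      λ c c≢a c≢b → transpose-other (c≢a ∘ preimage) (c≢b ∘ preimage)) ◅ ε , λ _ → refl
    where
    preimage : ∀ {c l} → σ ⟨$⟩ʳ c ≡ l → c ≡ σ ⟨$⟩ˡ l
    preimage refl = sym (inverseˡ σ)

  same : p i ≡ p j → ∀ m → n ∸ k (fromℕ (2 + s)) ≡ 2 + m → Exchangeable X Y (σ ⟨$⟩ʳ_) i j
  -- The induction starts from the full vertex set, where everybody stands; `edge` serves to show
  -- that `i` and `j` are distinct.
  same i~j m size with representatives
  ... | r , r' , r≢c , r'≢c , r≢r' = exchange-within n (∣p∣≤n ⊤) (record
      { connected = λ _ _ → Star.map (λ e → ∈⊤ , ∈⊤ , e) (conn _ _)
      ; noBridge = noBridge-⊤ X acyclic (subst (¬_ ∘ HasBridge X) size ¬bridge)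
      ; injective = λ eq → trans (sym (inverseˡ σ)) (trans (cong (σ ⟨$⟩ˡ_) eq) (inverseˡ σ))
      ; contains = λ _ → located
      }) refl (sym i~j) (λ { refl → Edge-irrefl X edge refl }) located located
    where
    open OneColour X Y p (part⇒Edge n (tabulate k)) (Edge⇒part n (tabulate k)) acyclic (p i)
      r≢c r'≢c r≢r' others! others≢c (subst (_≤ length others) size others-length)
    located : ∀ {l} → InImage ⊤ (σ ⟨$⟩ʳ_) l
    located = _ , ∈⊤ , inverseʳ σ

  proof : Exchangeable X Y (σ ⟨$⟩ʳ_) i j
  proof with p i ℕ.≟ p j
  ... | no i≢j = different i≢j
  ... | yes i~j = same i~j _ (sym (ℕₚ.m+[n∸m]≡n two≤))
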